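{- Let $\mathcal I=(S,C,T,\mathbf{p},\mathbf{c})$ be a DFEP instance in which every test has unit cost. Let $D_E$ and $D_W$ be decision trees for $\mathcal I$, where $D_E$ has expected testing cost $E$ and $D_W$ has height $W$, and let $\rho>0$ be such that $\rho=i/W$ for some integer $i$. Then there is a polynomial-time algorithm that constructs a decision tree $D$ for $\mathcal I$ with height at most $(1+\rho)W$ and expected testing cost at most $\left(1+\frac{2}{\rho^2+2\rho}\right)E$.
   Context: A DFEP instance $(S,C,T,\mathbf{p},\mathbf{c})$: $S$ a finite set of objects partitioned into classes $C$; $T$ a complete set of tests $t:S\to\{1,\dots,\ell\}$ (any two distinct objects are distinguished by some test); $\mathbf p$ a probability distribution on $S$; $\mathbf c$ assigns each test a cost, here all equal to $1$. A decision tree is a leaf labeled with a class if all objects in the current set belong to that class; otherwise its root is labeled with a test $t$ and its children are decision trees for the nonempty sets $\{s: t(s)=i\}$ within the current set. $cost(D,s)$ is the sum of the test costs on the root-to-leaf path of object $s$ (with unit costs, the number of tests on it); the expected testing cost is $\sum_s cost(D,s)p(s)$, and the height is $\max_s cost(D,s)$.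
   Formalization: The probabilities p(s), and hence the expected testing cost E, are taken to be rational numbers rather than arbitrary reals, so that an instance is a finite input to the algorithm. -}

module Defs where

open import Data.Nat.Base as ℕ using (ℕ; zero; suc; _⊔_)
open import Data.Nat.Logarithm using (⌈log₂_⌉)
open import Data.Integer.Base using (∣_∣; +_)
open import Data.Rational.Base as ℚ using (ℚ; 0ℚ; 1ℚ; Positive; NonZero; ↥_; ↧ₙ_)
open import Data.Rational.Properties using (pos+pos⇒pos; pos*pos⇒pos; pos⇒nonZero)
open import Algebra.Definitions.RawMonoid ℚ.+-0-rawMonoid using () renaming (sum to ∑)
open import Data.Fin.Base using (Fin; zero; toℕ)
open import Data.Fin.Properties using (_≟_)
open import Data.Fin.Subset using (Subset; _∈_; _∩_; ⊤; Nonempty; Empty)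
open import Data.List.Base as List using (List; []; _∷_; concat)
open import Data.Vec.Base as Vec using (Vec; []; _∷_; lookup)
import Data.Vec.Functional as Vector
open import Data.Product.Base using (∃-syntax)
open import Function.Definitions using (Surjective)
open import Relation.Nullary.Decidable using (does)
open import Relation.Nullary.Negation using (¬_)
open import Relation.Binary.PropositionalEquality.Core using (_≡_; _≢_)

------------------------------------------------------------------------
-- DFEP instances and decision trees

-- Probabilities are rational so that an instance is a finite input.
record DFEP : Set where
  field
    #objects #classes #tests ℓ : ℕ

  Object : Set
  Object = Fin #objects

  Class : Set
  Class = Fin #classes

  Test : Set
  Test = Fin #tests

  Outcome : Set
  Outcome = Fin ℓ

  field
    class            : Object → Class
    class-surjective : Surjective _≡_ _≡_ class
    test             : Test → Object → Outcome
    complete         : ∀ {s s′} → s ≢ s′ → ∃[ t ] test t s ≢ test t s′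
    p                : Object → ℚ
    p-nonNegative    : ∀ s → 0ℚ ℚ.≤ p s
    p-total          : ∑ p ≡ 1ℚ
    c                : Test → ℕ

module _ (I : DFEP) where
  open DFEP I

  UnitCost : Set
  UnitCost = ∀ t → c t ≡ 1

  AllIn : Subset #objects → Class → Set
  AllIn U γ = ∀ {s} → s ∈ U → class s ≡ γ

  outcomeSet : Subset #objects → Test → Outcome → Subset #objects
  outcomeSet U t i = U ∩ Vec.tabulate (λ s → does (test t s ≟ i))

  mutual
    -- Decision trees for the set of objects U.
    data Tree (U : Subset #objects) : Set where
      leaf : (γ : Class) → AllIn U γ → Tree U
      node : (t : Test) → ¬ (∃[ γ ] AllIn U γ) →
             ((i : Outcome) → Branch (outcomeSet U t i)) → Tree U

    -- There is a child exactly for the outcomes that occur.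
    data Branch (U : Subset #objects) : Set where
      none  : Empty U → Branch U
      child : Nonempty U → Tree U → Branch U

  DecisionTree : Set
  DecisionTree = Tree ⊤

module _ {I : DFEP} where
  open DFEP I

  -- The clause for none is never reached from an object of U.
  mutual
    cost : ∀ {U} → Tree I U → Object → ℕ
    cost (leaf _ _)    s = 0
    cost (node t _ bs) s = c t ℕ.+ branchCost (bs (test t s)) s

    branchCost : ∀ {U} → Branch I U → Object → ℕ
    branchCost (none _)    s = 0
    branchCost (child _ D) s = cost D s

  height : DecisionTree I → ℕ
  height D = Vector.foldr _⊔_ 0 (cost D)

  expectedCost : DecisionTree I → ℚ
  expectedCost D = ∑ λ s → (+ cost D s ℚ./ 1) ℚ.* p s

ρ²+2ρ-nonZero : ∀ ρ → .{{Positive ρ}} → NonZero (ρ ℚ.* ρ ℚ.+ (+ 2 ℚ./ 1) ℚ.* ρ)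
ρ²+2ρ-nonZero ρ = pos⇒nonZero (ρ ℚ.* ρ ℚ.+ 2ℚ ℚ.* ρ)
  {{pos+pos⇒pos (ρ ℚ.* ρ) {{pos*pos⇒pos ρ ρ}} (2ℚ ℚ.* ρ) {{pos*pos⇒pos 2ℚ ρ}}}}
  where 2ℚ = + 2 ℚ./ 1

------------------------------------------------------------------------
-- Model of computation: a first-order, call-by-value language of mutually
-- recursive functions over binary trees with natural numbers at the
-- leaves.  Arithmetic is charged by the logarithmic criterion, and all
-- other steps take unit time (values are shared, not copied), so that
-- polynomial time here is polynomial time on Turing machines.

infixr 5 _∙_

data Value : Set where
  num : ℕ → Value
  _∙_ : Value → Value → Value

bits : ℕ → ℕ
bits n = ⌈log₂ suc n ⌉

size : Value → ℕ
size (num n) = suc (bits n)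
size (v ∙ w) = suc (size v ℕ.+ size w)

data Op : Set where
  add monus mul : Op

apply : Op → ℕ → ℕ → ℕ
apply add   = ℕ._+_
apply monus = ℕ._∸_
apply mul   = ℕ._*_

-- Expressions over F unary functions and Γ variables in scope.
data Exp (F Γ : ℕ) : Set where
  var   : Fin Γ → Exp F Γ
  lit   : ℕ → Exp F Γ
  op    : Op → Exp F Γ → Exp F Γ → Exp F Γ
  pair  : Exp F Γ → Exp F Γ → Exp F Γ
  ifz   : Exp F Γ → Exp F Γ → Exp F Γ → Exp F Γ
  split : Exp F Γ → Exp F (1 ℕ.+ Γ) → Exp F (2 ℕ.+ Γ) → Exp F Γ
  bind  : Exp F Γ → Exp F (1 ℕ.+ Γ) → Exp F Γ
  call  : Fin F → Exp F Γ → Exp F Γ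

-- The bodies of the functions; a program is run by calling the first.
record Program : Set where
  constructor program
  field
    {pred#functions} : ℕ
    bodies           : Vec (Exp (suc pred#functions) 1) (suc pred#functions)

-- fs ⨾ env ⊢ e ⇓ v ⟨ τ ⟩ : evaluating e takes time τ and yields v.
infix 3 _⨾_⊢_⇓_⟨_⟩

data _⨾_⊢_⇓_⟨_⟩ {F} (fs : Vec (Exp F 1) F) {Γ} (env : Vec Value Γ) :
     Exp F Γ → Value → ℕ → Set where

  ⇓var : ∀ {x} → fs ⨾ env ⊢ var x ⇓ lookup env x ⟨ 1 ⟩

  ⇓lit : ∀ {n} → fs ⨾ env ⊢ lit n ⇓ num n ⟨ 1 ⟩

  ⇓op : ∀ {o e₁ e₂ m n τ₁ τ₂} →
        fs ⨾ env ⊢ e₁ ⇓ num m ⟨ τ₁ ⟩ →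
        fs ⨾ env ⊢ e₂ ⇓ num n ⟨ τ₂ ⟩ →
        fs ⨾ env ⊢ op o e₁ e₂ ⇓ num (apply o m n)
          ⟨ suc (bits m ℕ.+ bits n) ℕ.+ (τ₁ ℕ.+ τ₂) ⟩

  ⇓pair : ∀ {e₁ e₂ v w τ₁ τ₂} →
          fs ⨾ env ⊢ e₁ ⇓ v ⟨ τ₁ ⟩ →
          fs ⨾ env ⊢ e₂ ⇓ w ⟨ τ₂ ⟩ →
          fs ⨾ env ⊢ pair e₁ e₂ ⇓ v ∙ w ⟨ suc (τ₁ ℕ.+ τ₂) ⟩

  ⇓ifz-zero : ∀ {e e₁ e₂ v τ τ₁} →
              fs ⨾ env ⊢ e ⇓ num 0 ⟨ τ ⟩ →
              fs ⨾ env ⊢ e₁ ⇓ v ⟨ τ₁ ⟩ →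
              fs ⨾ env ⊢ ifz e e₁ e₂ ⇓ v ⟨ suc (τ ℕ.+ τ₁) ⟩

  ⇓ifz-suc : ∀ {e e₁ e₂ n v τ τ₂} →
             fs ⨾ env ⊢ e ⇓ num (suc n) ⟨ τ ⟩ →
             fs ⨾ env ⊢ e₂ ⇓ v ⟨ τ₂ ⟩ →
             fs ⨾ env ⊢ ifz e e₁ e₂ ⇓ v ⟨ suc (τ ℕ.+ τ₂) ⟩

  ⇓split-num : ∀ {e e₁ e₂ n v τ τ₁} →
               fs ⨾ env ⊢ e ⇓ num n ⟨ τ ⟩ →
               fs ⨾ num n ∷ env ⊢ e₁ ⇓ v ⟨ τ₁ ⟩ →
               fs ⨾ env ⊢ split e e₁ e₂ ⇓ v ⟨ suc (τ ℕ.+ τ₁) ⟩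

  ⇓split-pair : ∀ {e e₁ e₂ u w v τ τ₂} →
                fs ⨾ env ⊢ e ⇓ u ∙ w ⟨ τ ⟩ →
                fs ⨾ u ∷ w ∷ env ⊢ e₂ ⇓ v ⟨ τ₂ ⟩ →
                fs ⨾ env ⊢ split e e₁ e₂ ⇓ v ⟨ suc (τ ℕ.+ τ₂) ⟩

  ⇓bind : ∀ {e₁ e₂ u v τ₁ τ₂} →
          fs ⨾ env ⊢ e₁ ⇓ u ⟨ τ₁ ⟩ →
          fs ⨾ u ∷ env ⊢ e₂ ⇓ v ⟨ τ₂ ⟩ →
          fs ⨾ env ⊢ bind e₁ e₂ ⇓ v ⟨ suc (τ₁ ℕ.+ τ₂) ⟩

  ⇓call : ∀ {f e u v τ₁ τ₂} →
          fs ⨾ env ⊢ e ⇓ u ⟨ τ₁ ⟩ →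
          fs ⨾ u ∷ [] ⊢ lookup fs f ⇓ v ⟨ τ₂ ⟩ →
          fs ⨾ env ⊢ call f e ⇓ v ⟨ suc (τ₁ ℕ.+ τ₂) ⟩

_on_yields_inTime_ : Program → Value → Value → ℕ → Set
P on input yields output inTime τ =
  bodies ⨾ input ∷ [] ⊢ lookup bodies zero ⇓ output ⟨ τ ⟩
  where open Program P

------------------------------------------------------------------------
-- Inputs and outputs as values

encodeList : List Value → Value
encodeList []       = num 0
encodeList (v ∷ vs) = v ∙ encodeList vs

encodeFin : ∀ {n} → Fin n → Value
encodeFin i = num (toℕ i)

encodeVector : ∀ {n} → (Fin n → Value) → Value
encodeVector f = encodeList (List.tabulate f)

-- Used for non-negative rationals only.
encodeℚ : ℚ → Value
encodeℚ q = num ∣ ↥ q ∣ ∙ num (↧ₙ q)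

encodeDFEP : DFEP → Value
encodeDFEP I =
  (num #objects ∙ num #classes ∙ num #tests ∙ num ℓ) ∙
  encodeVector (λ s → encodeFin (class s)) ∙
  encodeVector (λ t → encodeVector (λ s → encodeFin (test t s))) ∙
  encodeVector (λ s → encodeℚ (p s)) ∙
  encodeVector (λ t → num (c t))
  where open DFEP I

module _ {I : DFEP} where
  open DFEP I

  -- Only the existing children of a node are listed, each with its
  -- outcome, so that the encoding does not grow with ℓ.
  mutual
    encodeTree : ∀ {U} → Tree I U → Value
    encodeTree (leaf γ _)    = num 0 ∙ encodeFin γ
    encodeTree (node t _ bs) = num 1 ∙ encodeFin t ∙
      encodeList (concat (List.tabulate (λ i → encodeBranch i (bs i))))

    encodeBranch : ∀ {U} → Outcome → Branch I U → List Value
    encodeBranch i (none _)    = []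
    encodeBranch i (child _ D) = (encodeFin i ∙ encodeTree D) ∷ []

encodeInput : (I : DFEP) → DecisionTree I → DecisionTree I → ℚ → Value
encodeInput I D-E D-W ρ =
  encodeDFEP I ∙ encodeTree D-E ∙ encodeTree D-W ∙ encodeℚ ρ

{-# OPTIONS --safe #-}

-- Cut D-E at a depth j ≤ i = ρW and hang below each cut node the tree D-W,
-- restricted to the objects that reach the node.  The height is at most
-- j + W, and an object of depth d in D-E costs at most d if d ≤ j and j + W
-- otherwise; the algorithm takes the j that minimises the expectation M of
-- this bound.  Let A j be the expectation of d ⊓ j and Q j the probability
-- of d > j.  Then M ≤ A j + W Q j and A (1 + j) = A j + Q j, so M − A j
-- shrinks by the factor 1 − 1/W in each step, and
-- M − E ≤ M − A i ≤ (1 − 1/W)ⁱ M ≤ M / (1 + ρ + ρ²/2).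

module Submission where

open import Defs

-- All arithmetic of the algorithm is exact and on integers. With ρ = a/b, the condition j ≤ ρW is
-- tested as j * b ≤ a * W, and expectations are compared by their numerators over the product of
-- all denominators of p. Such numbers can be exponentially large while their bit length stays
-- polynomial, so numbers are bounded by value where they govern recursion and by bit length where
-- they are only computed with. Since ρ is given in binary, ρW may be exponential too; the search
-- for j therefore ends at the height of D-E, beyond which a cut changes nothing.
--
-- Restricting D-W to the objects at a cut is more than intersecting sets: a node over a set of a
-- single class, or a child for an empty set, is not a legal tree. Each set met on the way is
-- therefore surveyed, and the recursion stops where it is empty or of one class.
--
-- Running times are only bounded by powers of N = 512 * S, where S is the size of the input. The
-- steps and calls of one body number at most 512, so a body raises the power by one, and a
-- recursion over at most N items raises it by one more; the whole program stays below N to the 8.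

-- Weakest preconditions and time accounting.

module Evaluation where

  open import Data.Nat.Base as ℕ using (ℕ; zero; suc; _+_; _*_; _^_; _≤_; z≤n; s≤s; _≤ᵇ_)
  open import Data.Nat.Properties as ℕ
  open import Data.Nat.Solver using (module +-*-Solver)
  open import Data.Nat.ListAction using (sum)
  open import Data.Nat.ListAction.Properties using (sum-++)
  open import Data.Bool.Base using (T)
  open import Data.Empty using (⊥)
  open import Data.Fin.Base using (Fin)
  open import Data.List.Base as List using (List; []; _∷_; _++_; length)
  open import Data.List.Relation.Unary.All using (All; []; _∷_)
  open import Data.Vec.Base using (Vec; []; _∷_; lookup)
  open import Data.Product.Base using (∃-syntax; _×_; _,_)
  open import Relation.Nullary.Negation using (contradiction)
  open import Relation.Binary.PropositionalEquality.Core using (_≡_; _≢_; refl; sym; cong)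

  private
    variable
      F Γ : ℕ

  -- Continuations receive the value, the number of steps made so far (counted
  -- in units of N) and the time bounds of the calls made so far.
  Cont : Set₁
  Cont = Value → ℕ → List ℕ → Set

  ifzP : Value → Set → Set → Set
  ifzP (num zero)    A B = A
  ifzP (num (suc _)) A B = B
  ifzP (_ ∙ _)       A B = ⊥

  splitP : Value → (Value → Set) → (Value → Value → Set) → Set
  splitP (num n) A B = A (num n)
  splitP (u ∙ w) A B = B u w

  -- A record and not a synonym, so that `c` and `r` can be recovered by unification; from the
  -- normalised sum they could not.
  record Fits (N c : ℕ) (r : List ℕ) (B : ℕ) : Set where
    constructor within
    field
      bound : c * N + sum r ≤ B

  -- Only the bit length is bounded, as the numerators and denominators of expectations may be
  -- exponential in `N`.
  record Short (N n : ℕ) : Set where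
    constructor short
    field
      bits≤ : bits n ≤ N

  module Run (fs : Vec (Exp F 1) F) (N : ℕ) where

    record Calls (f : Fin F) (u v : Value) (B : ℕ) : Set where
      constructor called
      field
        {time} : ℕ
        evaluates : fs ⨾ u ∷ [] ⊢ lookup fs f ⇓ v ⟨ time ⟩
        time≤     : time ≤ B

    -- Two `Short` operands keep the charge `suc (bits m + bits n)` within `N + N + N`, the three
    -- units that `wp` adds for an operation.
    opP : Op → Value → Value → (Value → Set) → Set
    opP o (num m) (num n) Q = Short N m × Short N n × Q (num (apply o m n))
    opP o (num _) (_ ∙ _) Q = ⊥
    opP o (_ ∙ _) _       Q = ⊥

    -- A weakest precondition: it reduces by computation to the obligations
    -- left by the operations and the calls.
    wp : Exp F Γ → Vec Value Γ → ℕ → List ℕ → Cont → Set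
    wp (var x)         env c r Q = Q (lookup env x) (suc c) r
    wp (lit n)         env c r Q = Q (num n) (suc c) r
    wp (op o e₁ e₂)    env c r Q = wp e₁ env (3 + c) r λ v c r → wp e₂ env c r λ w c r →
                                   opP o v w λ u → Q u c r
    wp (pair e₁ e₂)    env c r Q = wp e₁ env (suc c) r λ v c r → wp e₂ env c r λ w → Q (v ∙ w)
    wp (ifz e e₁ e₂)   env c r Q = wp e env (suc c) r λ v c r →
                                   ifzP v (wp e₁ env c r Q) (wp e₂ env c r Q)
    wp (split e e₁ e₂) env c r Q = wp e env (suc c) r λ v c r →
                                   splitP v (λ n → wp e₁ (n ∷ env) c r Q)
                                            (λ u w → wp e₂ (u ∷ w ∷ env) c r Q)
    wp (bind e₁ e₂)    env c r Q = wp e₁ env (suc c) r λ v c r → wp e₂ (v ∷ env) c r Q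
    wp (call f e)      env c r Q = wp e env (suc c) r λ u c r →
                                   ∃[ v ] ∃[ B ] Calls f u v B × Q v c (B ∷ r)

    -- The bound is relative: `time` is paid for by the growth of the counters from `c` and `r` to
    -- `steps` and `calls`, so that consecutive evaluations telescope.
    record Outcome⟨_⟩ {Γ : ℕ} (e : Exp F Γ) (env : Vec Value Γ) (c : ℕ) (r : List ℕ) (Q : Cont) : Set where
      constructor outcome
      field
        {value} : Value
        {time steps} : ℕ
        {calls} : List ℕ
        evaluates : fs ⨾ env ⊢ e ⇓ value ⟨ time ⟩
        bounded : time + (c * N + sum r) ≤ steps * N + sum calls
        holds : Q value steps calls

    module _ .{{_ : ℕ.NonZero N}} where

      private
        1≤N : 1 ≤ N
        1≤N = ℕ.>-nonZero⁻¹ N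

        step : ∀ τ c r {x} → τ + (suc c * N + sum r) ≤ x → suc τ + (c * N + sum r) ≤ x
        step τ c r h = ≤-trans (≤-trans (≤-reflexive (sym (+-suc τ _)))
          (+-monoʳ-≤ τ (+-monoˡ-≤ (sum r) (+-monoˡ-≤ (c * N) 1≤N)))) h

        compose : ∀ τ₁ τ₂ {x y z} → τ₁ + x ≤ y → τ₂ + y ≤ z → (τ₁ + τ₂) + x ≤ z
        compose τ₁ τ₂ {x} {y} {z} h₁ h₂ = begin
          τ₁ + τ₂ + x   ≡⟨ cong (_+ x) (+-comm τ₁ τ₂) ⟩
          τ₂ + τ₁ + x   ≡⟨ +-assoc τ₂ τ₁ x ⟩
          τ₂ + (τ₁ + x) ≤⟨ +-monoʳ-≤ τ₂ h₁ ⟩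
          τ₂ + y        ≤⟨ h₂ ⟩
          z             ∎
          where open ≤-Reasoning

        op-step : ∀ {a b} τ c r {x} → a ≤ N → b ≤ N →
                  τ + ((3 + c) * N + sum r) ≤ x → (suc (a + b) + τ) + (c * N + sum r) ≤ x
        op-step {a} {b} τ c r {x} a≤N b≤N h = begin
          suc (a + b) + τ + (c * N + sum r)   ≤⟨ +-monoˡ-≤ (c * N + sum r)
            (+-monoˡ-≤ τ (+-mono-≤ 1≤N (+-mono-≤ a≤N b≤N))) ⟩
          N + (N + N) + τ + (c * N + sum r)   ≡⟨ solve 4 (λ n t k s →
            n :+ (n :+ n) :+ t :+ (k :+ s) := t :+ (n :+ (n :+ (n :+ k)) :+ s)) refl N τ (c * N) (sum r) ⟩
          τ + ((3 + c) * N + sum r)           ≤⟨ h ⟩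
          x                                   ∎
          where
          open ≤-Reasoning
          open +-*-Solver

      -- Induction along the clauses of `wp`: `compose` telescopes the bounds of the parts, `step`
      -- pays the unit of the construct itself, and the `⊥` clauses exclude stuck evaluations.
      sound : ∀ (e : Exp F Γ) {env c r Q} → wp e env c r Q → Outcome⟨ e ⟩ env c r Q
      sound (var x) {c = c} {r} q = outcome ⇓var (step 0 c r ≤-refl) q
      sound (lit n) {c = c} {r} q = outcome ⇓lit (step 0 c r ≤-refl) q
      sound (op o e₁ e₂) {c = c} {r} h with sound e₁ h
      ... | outcome {v} {τ₁} d₁ b₁ h₁ with sound e₂ h₁
      ... | outcome {w} {τ₂} d₂ b₂ h₂ with v | w | h₂
      ... | num m | num n | short m≤ , short n≤ , q =
        outcome (⇓op d₁ d₂) (op-step (τ₁ + τ₂) c r m≤ n≤ (compose τ₁ τ₂ b₁ b₂)) q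
      sound (pair e₁ e₂) {c = c} {r} h with sound e₁ h
      ... | outcome {time = τ₁} d₁ b₁ h₁ with sound e₂ h₁
      ... | outcome {time = τ₂} d₂ b₂ q = outcome (⇓pair d₁ d₂) (step (τ₁ + τ₂) c r (compose τ₁ τ₂ b₁ b₂)) q
      sound (ifz e e₁ e₂) {c = c} {r} h with sound e h
      ... | outcome {num zero} {τ₁} d₁ b₁ h₁ with sound e₁ h₁
      ...   | outcome {time = τ₂} d₂ b₂ q = outcome (⇓ifz-zero d₁ d₂) (step (τ₁ + τ₂) c r (compose τ₁ τ₂ b₁ b₂)) q
      sound (ifz e e₁ e₂) {c = c} {r} h | outcome {num (suc _)} {τ₁} d₁ b₁ h₁ with sound e₂ h₁
      ...   | outcome {time = τ₂} d₂ b₂ q = outcome (⇓ifz-suc d₁ d₂) (step (τ₁ + τ₂) c r (compose τ₁ τ₂ b₁ b₂)) q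
      sound (split e e₁ e₂) {c = c} {r} h with sound e h
      ... | outcome {num _} {τ₁} d₁ b₁ h₁ with sound e₁ h₁
      ...   | outcome {time = τ₂} d₂ b₂ q = outcome (⇓split-num d₁ d₂) (step (τ₁ + τ₂) c r (compose τ₁ τ₂ b₁ b₂)) q
      sound (split e e₁ e₂) {c = c} {r} h | outcome {_ ∙ _} {τ₁} d₁ b₁ h₁ with sound e₂ h₁
      ...   | outcome {time = τ₂} d₂ b₂ q = outcome (⇓split-pair d₁ d₂) (step (τ₁ + τ₂) c r (compose τ₁ τ₂ b₁ b₂)) q
      sound (bind e₁ e₂) {c = c} {r} h with sound e₁ h
      ... | outcome {time = τ₁} d₁ b₁ h₁ with sound e₂ h₁
      ... | outcome {time = τ₂} d₂ b₂ q = outcome (⇓bind d₁ d₂) (step (τ₁ + τ₂) c r (compose τ₁ τ₂ b₁ b₂)) q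
      sound (call f e) {c = c} {r} h with sound e h
      ... | outcome {time = τ₁} {c′} {r′} d₁ b₁ (v , B , called {τ₂} d₂ τ₂≤B , q) =
        outcome (⇓call d₁ d₂) (step (τ₁ + τ₂) c r (compose τ₁ τ₂ b₁ (begin
          τ₂ + (c′ * N + sum r′) ≤⟨ +-monoˡ-≤ (c′ * N + sum r′) τ₂≤B ⟩
          B + (c′ * N + sum r′)  ≡⟨ solve 3 (λ b k s → b :+ (k :+ s) := k :+ (b :+ s)) refl B (c′ * N) (sum r′) ⟩
          c′ * N + (B + sum r′)  ∎))) q
        where
        open ≤-Reasoning
        open +-*-Solver

      record Return (v : Value) (B : ℕ) (v′ : Value) (c : ℕ) (r : List ℕ) : Set where
        constructor return
        field
          result : v′ ≡ v
          fits   : Fits N c r B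

      -- Starting from empty counters turns the relative bound of `sound` into an absolute one.
      -- Verifying a body thus amounts to inhabiting its reduced precondition.
      calls : ∀ f {u v B} → wp (lookup fs f) (u ∷ []) 0 [] (Return v B) → Calls f u v B
      calls f h with sound (lookup fs f) h
      ... | outcome {time = τ} d b (return refl (within fits)) = called d (begin
        τ     ≡⟨ +-identityʳ τ ⟨
        τ + 0 ≤⟨ b ⟩
        _     ≤⟨ fits ⟩
        _     ∎)
        where open ≤-Reasoning

    weaken : ∀ {f u v B B′} → B ≤ B′ → Calls f u v B → Calls f u v B′
    weaken B≤B′ (called d τ≤B) = called d (≤-trans τ≤B B≤B′)

  -- For a scrutinee known to vanish only through an equation, where `ifzP` does not reduce.
  if-zero : ∀ {n A B} → n ≡ 0 → A → ifzP (num n) A B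
  if-zero refl a = a

  if-nonzero : ∀ {n A B} → n ≢ 0 → B → ifzP (num n) A B
  if-nonzero {zero}  n≢0 b = contradiction refl n≢0
  if-nonzero {suc _} n≢0 b = b

  -- Powers of `N` as a scale of running times.

  module Levels (N : ℕ) (512≤N : 512 ≤ N) where

    instance
      N-nonZero : ℕ.NonZero N
      N-nonZero = ℕ.>-nonZero (≤-trans (s≤s z≤n) 512≤N)

    opaque
      level : ℕ → ℕ
      level e = N ^ suc e

      level-zero : level 0 ≡ N
      level-zero = *-identityʳ N

      level-suc : ∀ e → level (suc e) ≡ N * level e
      level-suc e = refl

      level-^ : ∀ e → level e ≡ N ^ suc e
      level-^ e = refl

      level-mono : ∀ {d e} → d ≤ e → level d ≤ level e
      level-mono d≤e = ^-monoʳ-≤ N (s≤s d≤e)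

    N≤level : ∀ e → N ≤ level e
    N≤level e = ≤-trans (≤-reflexive (sym level-zero)) (level-mono {0} {e} z≤n)

    scale : ∀ {n e} → n ≤ N → n * level e ≤ level (suc e)
    scale {n} {e} n≤N = ≤-trans (*-monoˡ-≤ (level e) n≤N) (≤-reflexive (sym (level-suc e)))

    private
      sum≤length* : ∀ {B r} → All (_≤ B) r → sum r ≤ length r * B
      sum≤length* []       = z≤n
      sum≤length* (p ∷ ps) = +-mono-≤ p (sum≤length* ps)

    private
      fits-≤ : ∀ c r {e} → T (c + length r ≤ᵇ 512) → All (_≤ level e) r → c * N + sum r ≤ level (suc e)
      fits-≤ c r {e} small ps = begin
        c * N + sum r                    ≤⟨ +-mono-≤ (*-monoʳ-≤ c (N≤level e)) (sum≤length* ps) ⟩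
        c * level e + length r * level e ≡⟨ *-distribʳ-+ (level e) c (length r) ⟨
        (c + length r) * level e         ≤⟨ scale (≤-trans (≤ᵇ⇒≤ (c + length r) 512 small) 512≤N) ⟩
        level (suc e)                    ∎
        where open ≤-Reasoning

    -- Steps and calls together number at most 512, hence at most `N`, and each is worth at most
    -- `level e`. For a concrete body the count is a numeral, so the `T` argument is settled by
    -- evaluation.
    fits : ∀ {c r e} {_ : T (c + length r ≤ᵇ 512)} → All (_≤ level e) r → Fits N c r (level (suc e))
    fits {c} {r} {_} {small} ps = within (fits-≤ c r small ps)

    -- The bound `R` of the recursive call keeps coefficient one, so unwinding adds one
    -- `level (suc e)` per item instead of raising the level at every item.
    fits-recursion : ∀ xs {ys c R e} {_ : T (c + length (xs ++ ys) ≤ᵇ 512)} → All (_≤ level e) (xs ++ ys) →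
                     Fits N c (xs ++ R ∷ ys) (level (suc e) + R)
    fits-recursion xs {ys} {c} {R} {e} {small} ps = within (begin
      c * N + sum (xs ++ R ∷ ys)      ≡⟨ cong (c * N +_) (sum-++ xs (R ∷ ys)) ⟩
      c * N + (sum xs + (R + sum ys)) ≡⟨ solve 4 (λ k x a y → k :+ (x :+ (a :+ y)) := k :+ (x :+ y) :+ a) refl (c * N) (sum xs) R (sum ys) ⟩
      c * N + (sum xs + sum ys) + R   ≡⟨ cong (λ s → c * N + s + R) (sum-++ xs ys) ⟨
      c * N + sum (xs ++ ys) + R      ≤⟨ +-monoˡ-≤ R (fits-≤ c (xs ++ ys) small ps) ⟩
      level (suc e) + R               ∎)
      where
      open ≤-Reasoning
      open +-*-Solver

    -- Made for `pruneListᶠ`: `R₁` belongs to the child, `R₂` to the rest of the list, and `b` to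
    -- the selection between these two calls.
    fits-recursion₂ : ∀ {c R₁ b R₂ e} {_ : T (c + 1 ≤ᵇ 512)} → b ≤ level e →
                      Fits N c (R₁ ∷ b ∷ R₂ ∷ []) (level (suc e) + (R₁ + R₂))
    fits-recursion₂ {c} {R₁} {b} {R₂} {e} {small} b≤ = within (begin
      c * N + (R₁ + (b + (R₂ + 0)))   ≡⟨ solve 4 (λ k x a y → k :+ (x :+ (a :+ (y :+ con 0))) := k :+ (a :+ con 0) :+ (x :+ y)) refl (c * N) R₁ b R₂ ⟩
      c * N + (b + 0) + (R₁ + R₂)     ≤⟨ +-monoˡ-≤ (R₁ + R₂) (fits-≤ c (b ∷ []) small (b≤ ∷ [])) ⟩
      level (suc e) + (R₁ + R₂)       ∎)
      where
      open ≤-Reasoning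
      open +-*-Solver

-- The program.

module Algorithm where

  open import Data.Nat.Base using (ℕ; zero; suc)
  open import Data.Nat.Properties using (_<?_)
  open import Data.Fin.Base using (zero; suc; fromℕ<)
  open import Data.Vec.Base using (Vec; []; _∷_)
  open import Relation.Nullary.Decidable using (True; toWitness)

  private
    variable
      Γ : ℕ

  Code : ℕ → Set
  Code Γ = Exp 14 Γ

  pattern mainᶠ       = zero
  pattern nthᶠ        = suc zero
  pattern assocᶠ      = suc (suc zero)
  pattern depthᶠ      = suc (suc (suc zero))
  pattern depthsᶠ     = suc (suc (suc (suc zero)))
  pattern maximumᶠ    = suc (suc (suc (suc (suc zero))))
  pattern detourᶠ     = suc (suc (suc (suc (suc (suc zero)))))
  pattern weighᶠ      = suc (suc (suc (suc (suc (suc (suc zero))))))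
  pattern bestᶠ       = suc (suc (suc (suc (suc (suc (suc (suc zero)))))))
  pattern surveyᶠ     = suc (suc (suc (suc (suc (suc (suc (suc (suc zero))))))))
  pattern selectᶠ     = suc (suc (suc (suc (suc (suc (suc (suc (suc (suc zero)))))))))
  pattern pruneᶠ      = suc (suc (suc (suc (suc (suc (suc (suc (suc (suc (suc zero))))))))))
  pattern pruneListᶠ  = suc (suc (suc (suc (suc (suc (suc (suc (suc (suc (suc (suc zero)))))))))))
  pattern allᶠ        = suc (suc (suc (suc (suc (suc (suc (suc (suc (suc (suc (suc (suc zero))))))))))))

  x : ∀ m {Γ} {m<Γ : True (m <? Γ)} → Code Γ
  x m {m<Γ = m<Γ} = var (fromℕ< (toWitness m<Γ))

  -- Only applied to pairs.
  unpack : Code Γ → Code (suc (suc Γ)) → Code Γ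
  unpack e = split e (lit 0)

  -- Serves as the equality test: since `monus` truncates, the sum vanishes exactly when the numbers
  -- agree.
  differ : Code Γ → Code Γ → Code Γ
  differ e₁ e₂ = op add (op monus e₁ e₂) (op monus e₂ e₁)

  -- The comments give the arguments of the functions as tuples associated to
  -- the right.  Variables are de Bruijn indices; unpack binds the left component
  -- as x 0 and the right one as x 1.

  -- (list , index)
  nthᵇ : Code 1
  nthᵇ =
    unpack (x 0) (unpack (x 0) (ifz (x 3) (x 0) (call nthᶠ (pair (x 1) (op monus (x 3) (lit 1))))))

  -- (association list , key)
  assocᵇ : Code 1
  assocᵇ =
    unpack (x 0) (unpack (x 0) (unpack (x 0)
      (ifz (differ (x 0) (x 5)) (x 1) (call assocᶠ (pair (x 3) (x 5))))))

  -- (tests , tree , object)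
  depthᵇ : Code 1
  depthᵇ =
    unpack (x 0) (unpack (x 1) (unpack (x 0)
      (ifz (x 0)
        (lit 0)
        (unpack (x 1)
          (op add (lit 1)
            (call depthᶠ (pair (x 6) (pair
              (call assocᶠ (pair (x 1) (call nthᶠ (pair (call nthᶠ (pair (x 6) (x 0))) (x 5)))))
              (x 5)))))))))

  -- (tests , tree , first object , list with an entry for each object)
  depthsᵇ : Code 1
  depthsᵇ =
    unpack (x 0) (unpack (x 1) (unpack (x 1)
      (split (x 1)
        (lit 0)
        (pair (call depthᶠ (pair (x 6) (pair (x 4) (x 2))))
              (call depthsᶠ (pair (x 6) (pair (x 4) (pair (op add (lit 1) (x 2)) (x 1)))))))))

  maximumᵇ : Code 1
  maximumᵇ =
    split (x 0)
      (lit 0)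
      (bind (call maximumᶠ (x 1)) (op add (x 0) (op monus (x 1) (x 0))))

  -- (d , j , W)
  detourᵇ : Code 1
  detourᵇ =
    unpack (x 0) (unpack (x 1)
      (ifz (op monus (x 2) (x 0)) (x 2) (op add (x 0) (x 1))))

  -- (probabilities , depths , j , W)
  weighᵇ : Code 1
  weighᵇ =
    unpack (x 0) (unpack (x 1)
      (split (x 2)
        (pair (lit 0) (lit 1))
        (unpack (x 2) (unpack (x 2)
          (unpack (call weighᶠ (pair (x 5) (pair (x 3) (x 7))))
            (pair
              (op add (op mul (op mul (x 2) (call detourᶠ (pair (x 4) (x 9)))) (x 1)) (op mul (x 3) (x 0)))
              (op mul (x 3) (x 1))))))))

  -- (k , ρ , probabilities , depths , W)
  bestᵇ : Code 1
  bestᵇ =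
    unpack (x 0)
      (ifz (x 0)
        (lit 0)
        (bind (call bestᶠ (pair (op monus (x 0) (lit 1)) (x 1)))
          (unpack (x 2) (unpack (x 0) (unpack (x 3) (unpack (x 1)
            (ifz (op monus (op mul (x 9) (x 5)) (op mul (x 4) (x 1)))
              (unpack (call weighᶠ (pair (x 2) (pair (x 0) (pair (x 9) (x 1)))))
                (unpack (call weighᶠ (pair (x 4) (pair (x 2) (pair (x 10) (x 3)))))
                  (ifz (op monus (x 0) (x 2)) (x 12) (x 13))))
              (x 8))))))))

  -- (classes , set)
  surveyᵇ : Code 1
  surveyᵇ =
    unpack (x 0)
      (split (x 0)
        (lit 0)
        (unpack (x 3)
          (bind (call surveyᶠ (pair (x 3) (x 1)))
            (ifz (x 1)
              (x 0)
              (split (x 0)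
                (ifz (x 0)
                  (op add (lit 1) (x 4))
                  (ifz (differ (x 0) (op add (lit 1) (x 4))) (x 1) (pair (lit 0) (lit 0))))
                (pair (lit 0) (lit 0)))))))

  -- (outcomes of a test , set , outcome)
  selectᵇ : Code 1
  selectᵇ =
    unpack (x 0) (unpack (x 1)
      (split (x 2)
        (lit 0)
        (unpack (x 2)
          (bind (call selectᶠ (pair (x 3) (pair (x 1) (x 5))))
            (ifz (x 1)
              (pair (lit 0) (x 0))
              (ifz (differ (x 3) (x 6)) (pair (lit 1) (x 0)) (pair (lit 0) (x 0))))))))

  -- ((classes , tests , other tree) , mode , set , tree)
  pruneᵇ : Code 1
  pruneᵇ =
    unpack (x 0) (unpack (x 1) (unpack (x 1) (unpack (x 4)
      (split (call surveyᶠ (pair (x 0) (x 2)))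
        (ifz (x 0) (lit 0) (pair (pair (lit 0) (op monus (x 0) (lit 1))) (lit 0)))
        (unpack (x 5) (unpack (x 5)
          (ifz (differ (x 10) (lit 1))
            (call pruneᶠ (pair (x 12) (pair (lit 0) (pair (x 8) (x 1)))))
            (unpack (x 3)
              (pair (pair (lit 1) (pair (x 0) (call pruneListᶠ (pair (x 14)
                (pair (op monus (x 12) (lit 1)) (pair (x 10) (pair (call nthᶠ (pair (x 2) (x 0))) (x 1))))))))
                (lit 0))))))))))

  -- ((classes , tests , other tree) , mode , set , outcomes of a test , subtrees)
  pruneListᵇ : Code 1
  pruneListᵇ =
    unpack (x 0) (unpack (x 1) (unpack (x 1) (unpack (x 1)
      (split (x 1)
        (lit 0)
        (unpack (x 0)
          (bind (call pruneListᶠ (pair (x 10) (pair (x 8) (pair (x 6) (pair (x 4) (x 3))))))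
            (split (call pruneᶠ (pair (x 11) (pair (x 9) (pair
                     (call selectᶠ (pair (x 5) (pair (x 7) (x 1)))) (x 2)))))
              (x 1)
              (pair (pair (x 3) (x 0)) (x 2)))))))))

  -- The set of all objects, from a list with an entry for each object.
  allᵇ : Code 1
  allᵇ = split (x 0) (lit 0) (pair (lit 1) (call allᶠ (x 1)))

  mainᵇ : Code 1
  mainᵇ =
    unpack (x 0) (unpack (x 1) (unpack (x 1)
      (unpack (x 4) (unpack (x 1) (unpack (x 1) (unpack (x 1)
        (bind (call depthsᶠ (pair (x 2) (pair (x 10) (pair (lit 0) (x 0)))))
          (bind (call maximumᶠ (call depthsᶠ (pair (x 3) (pair (x 9) (pair (lit 0) (x 1))))))
            (bind (call bestᶠ (pair (call maximumᶠ (x 1)) (pair (x 11) (pair (x 2) (pair (x 1) (x 0))))))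
              (unpack (call pruneᶠ (pair (pair (x 7) (pair (x 5) (x 11)))
                                   (pair (op add (lit 1) (x 0)) (pair (call allᶠ (x 3)) (x 13)))))
                (x 0)))))))))))

  code : Vec (Code 1) 14
  code = mainᵇ ∷ nthᵇ ∷ assocᵇ ∷ depthᵇ ∷ depthsᵇ ∷ maximumᵇ ∷ detourᵇ ∷ weighᵇ ∷ bestᵇ ∷
         surveyᵇ ∷ selectᵇ ∷ pruneᵇ ∷ pruneListᵇ ∷ allᵇ ∷ []

-- Bit lengths, detours, integer expectations and surveys.

module Procedures where

  open Evaluation
  open Algorithm
  open import Data.Nat.Base as ℕ using (ℕ; zero; suc; _+_; _*_; _^_; _∸_; _⊔_; _≤_; _<_; z≤n; s≤s; ⌊_/2⌋; ⌈_/2⌉)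
  open import Data.Nat.Properties as ℕ hiding (_≟_; suc-injective)
  open import Data.Nat.Solver using (module +-*-Solver)
  open import Data.Nat.Induction using (<-rec)
  open import Data.Nat.Logarithm using (⌈log₂_⌉; ⌈log₂⌉-mono-≤; ⌈log₂2^n⌉≡n; ⌈log₂⌈n/2⌉⌉≡⌈log₂n⌉∸1)
  open import Data.Integer.Base using (∣_∣)
  open import Data.Rational.Base using (ℚ; ↥_; ↧ₙ_; mkℚ)
  open import Data.Bool.Base using (Bool; true; false)
  open import Data.Fin.Base using (Fin; zero; suc; toℕ)
  open import Data.Fin.Properties using (_≟_; toℕ<n; toℕ-injective)
  open import Data.Fin.Subset using (Subset; _∈_; _∩_; ⊤; Nonempty; Empty; inside; outside)
  open import Data.List.Base using ([]; _∷_)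
  open import Data.List.Relation.Unary.All using ([]; _∷_)
  open import Data.Vec.Base as Vec using (Vec; []; _∷_; here; there)
  import Data.Vec.Functional as Vector
  open import Data.Product.Base using (∃-syntax; _×_; _,_)
  open import Data.Sum.Base using (inj₁; inj₂)
  open import Function.Base using (_∘_)
  open import Relation.Nullary.Decidable using (does; yes; no)
  open import Relation.Nullary.Negation using (¬_; contradiction)
  open import Relation.Binary.PropositionalEquality.Core using (_≡_; _≢_; refl; sym; trans; cong; cong₂)

  n≤2*⌈n/2⌉ : ∀ n → n ≤ 2 * ⌈ n /2⌉
  n≤2*⌈n/2⌉ n = begin
    n                         ≡⟨ ⌊n/2⌋+⌈n/2⌉≡n n ⟨
    ⌊ n /2⌋ + ⌈ n /2⌉         ≤⟨ +-monoˡ-≤ ⌈ n /2⌉ (⌊n/2⌋≤⌈n/2⌉ n) ⟩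
    ⌈ n /2⌉ + ⌈ n /2⌉         ≡⟨ cong (⌈ n /2⌉ +_) (+-identityʳ ⌈ n /2⌉) ⟨
    2 * ⌈ n /2⌉               ∎
    where open ≤-Reasoning

  n≤2^⌈log₂n⌉ : ∀ n → n ≤ 2 ^ ⌈log₂ n ⌉
  n≤2^⌈log₂n⌉ = <-rec _ step
    where
    open ≤-Reasoning
    step : ∀ n → (∀ {m} → m < n → m ≤ 2 ^ ⌈log₂ m ⌉) → n ≤ 2 ^ ⌈log₂ n ⌉
    step zero            _   = z≤n
    step (suc zero)      _   = s≤s z≤n
    step n@(suc (suc m)) rec = begin
      n                            ≤⟨ n≤2*⌈n/2⌉ n ⟩
      2 * ⌈ n /2⌉                  ≤⟨ *-monoʳ-≤ 2 (rec (⌈n/2⌉<n m)) ⟩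
      2 * 2 ^ ⌈log₂ ⌈ n /2⌉ ⌉      ≡⟨ cong (λ k → 2 * 2 ^ k) (⌈log₂⌈n/2⌉⌉≡⌈log₂n⌉∸1 n) ⟩
      2 ^ ⌈log₂ n ⌉                ∎

  bits-mono : ∀ {m n} → m ≤ n → bits m ≤ bits n
  bits-mono m≤n = ⌈log₂⌉-mono-≤ (s≤s m≤n)

  n<2^bits : ∀ n → n < 2 ^ bits n
  n<2^bits n = n≤2^⌈log₂n⌉ (suc n)

  bits-<2^ : ∀ {n k} → n < 2 ^ k → bits n ≤ k
  bits-<2^ {k = k} n<2^k = ≤-trans (⌈log₂⌉-mono-≤ n<2^k) (≤-reflexive (⌈log₂2^n⌉≡n k))

  n<2^n : ∀ n → n < 2 ^ n
  n<2^n zero    = s≤s z≤n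
  n<2^n (suc n) = begin
    suc (suc n)       ≤⟨ s≤s (n<2^n n) ⟩
    1 + 2 ^ n         ≤⟨ +-monoˡ-≤ (2 ^ n) (m^n>0 2 n) ⟩
    2 ^ n + 2 ^ n     ≡⟨ cong (2 ^ n +_) (+-identityʳ (2 ^ n)) ⟨
    2 ^ suc n         ∎
    where open ≤-Reasoning

  bits≤ : ∀ n → bits n ≤ n
  bits≤ n = bits-<2^ (n<2^n n)

  bits-* : ∀ m n → bits (m * n) ≤ bits m + bits n
  bits-* m n = bits-<2^ (begin-strict
    m * n                   ≤⟨ *-monoˡ-≤ n (<⇒≤ (n<2^bits m)) ⟩
    2 ^ bits m * n          <⟨ *-monoʳ-< (2 ^ bits m) {{m^n≢0 2 (bits m)}} (n<2^bits n) ⟩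
    2 ^ bits m * 2 ^ bits n ≡⟨ ^-distribˡ-+-* 2 (bits m) (bits n) ⟨
    2 ^ (bits m + bits n)   ∎)
    where open ≤-Reasoning

  distance : ℕ → ℕ → ℕ
  distance m n = (m ∸ n) + (n ∸ m)

  distance-refl : ∀ n → distance n n ≡ 0
  distance-refl n = cong₂ _+_ (n∸n≡0 n) (n∸n≡0 n)

  distance-≢ : ∀ {m n} → m ≢ n → distance m n ≢ 0
  distance-≢ {m} {n} m≢n d≡0 = m≢n (≤-antisym (m∸n≡0⇒m≤n (m+n≡0⇒m≡0 (m ∸ n) d≡0)) (m∸n≡0⇒m≤n (m+n≡0⇒n≡0 (m ∸ n) d≡0)))

  ifZero : ∀ {A : Set} → ℕ → A → A → A
  ifZero zero    a b = a
  ifZero (suc _) a b = b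

  maximum : ∀ {n} → (Fin n → ℕ) → ℕ
  maximum = Vector.foldr _⊔_ 0

  maximum-≤ : ∀ {n b} (f : Fin n → ℕ) → (∀ i → f i ≤ b) → maximum f ≤ b
  maximum-≤ {zero}  f f≤b = z≤n
  maximum-≤ {suc n} f f≤b = ⊔-lub (f≤b zero) (maximum-≤ (f ∘ suc) (f≤b ∘ suc))

  ≤-maximum : ∀ {n} (f : Fin n → ℕ) i → f i ≤ maximum f
  ≤-maximum f zero    = m≤m⊔n _ _
  ≤-maximum f (suc i) = ≤-trans (≤-maximum (f ∘ suc) i) (m≤n⊔m (f zero) _)

  n+[m∸n]≡m⊔n : ∀ m n → n + (m ∸ n) ≡ m ⊔ n
  n+[m∸n]≡m⊔n m n with ≤-total m n
  ... | inj₁ m≤n = trans (cong (n +_) (m≤n⇒m∸n≡0 m≤n)) (trans (+-identityʳ n) (sym (m≤n⇒m⊔n≡n m≤n)))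
  ... | inj₂ n≤m = trans (m+[n∸m]≡n n≤m) (sym (m≥n⇒m⊔n≡m n≤m))

  -- The bound on the new cost of an object of depth `d`, spelled as the program computes it:
  -- `d ∸ j` vanishes exactly if `d ≤ j`.
  detour : ℕ → ℕ → ℕ → ℕ
  detour j W d = ifZero (d ∸ j) d (j + W)

  detour-suc : ∀ j W d → suc (detour j W d) ≡ detour (suc j) W (suc d)
  detour-suc j W d with d ∸ j
  ... | zero  = refl
  ... | suc _ = refl

  detour-≤ : ∀ j W d → detour j W d ≤ j + W
  detour-≤ j W d with d ∸ j in eq
  ... | zero  = ≤-trans (m∸n≡0⇒m≤n eq) (m≤m+n j W)
  ... | suc _ = ≤-refl

  detour-id : ∀ {j W d} → d ≤ j → detour j W d ≡ d
  detour-id d≤j rewrite m≤n⇒m∸n≡0 d≤j = refl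

  -- The product is left unreduced: no gcd has to be computed, and its bit length is still bounded
  -- by the size of the encoded probabilities.
  denominator : ∀ {n} → (Fin n → ℚ) → ℕ
  denominator {zero}  p = 1
  denominator {suc n} p = ↧ₙ (p zero) * denominator (p ∘ suc)

  -- For non-negative `p`, dividing by `denominator p` gives the sum of `v s` times `p s`.
  numerator : ∀ {n} → (Fin n → ℚ) → (Fin n → ℕ) → ℕ
  numerator {zero}  p v = 0
  numerator {suc n} p v =
    ∣ ↥ p zero ∣ * v zero * denominator (p ∘ suc) + ↧ₙ (p zero) * numerator (p ∘ suc) (v ∘ suc)

  denominator>0 : ∀ {n} (p : Fin n → ℚ) → 1 ≤ denominator p
  denominator>0 {zero}  p = s≤s z≤n
  denominator>0 {suc n} p with p zero
  ... | mkℚ _ b-1 _ = *-mono-≤ {1} {suc b-1} (s≤s z≤n) (denominator>0 (p ∘ suc))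

  -- Each factor is below 2 to its number of bits, and these bits are part of the encoding, so the
  -- exponents add up to at most its size.
  denominator-≤ : ∀ {n} (p : Fin n → ℚ) → denominator p ≤ 2 ^ size (encodeVector (λ s → encodeℚ (p s)))
  numerator-≤ : ∀ {n V} (p : Fin n → ℚ) (v : Fin n → ℕ) → (∀ s → v s ≤ V) →
                numerator p v ≤ V * 2 ^ size (encodeVector (λ s → encodeℚ (p s)))

  private
    2^-size : ∀ a b X → 2 ^ (suc (bits a + bits b) + X) ≤ 2 ^ suc (size (num a ∙ num b) + X)
    2^-size a b X = ^-monoʳ-≤ 2 (m≤n⇒m≤1+n (+-monoˡ-≤ X (s≤s
      (≤-trans (+-monoʳ-≤ (bits a) (n≤1+n (bits b))) (n≤1+n _)))))

  denominator-≤ {zero}  p = s≤s z≤n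
  denominator-≤ {suc n} p = begin
    b * denominator (p ∘ suc)      ≤⟨ *-mono-≤ (<⇒≤ (n<2^bits b)) (denominator-≤ (p ∘ suc)) ⟩
    2 ^ bits b * 2 ^ X             ≡⟨ ^-distribˡ-+-* 2 (bits b) X ⟨
    2 ^ (bits b + X)               ≤⟨ ^-monoʳ-≤ 2 (+-monoˡ-≤ X (m≤n⇒m≤1+n (m≤n+m (bits b) (bits a)))) ⟩
    2 ^ (suc (bits a + bits b) + X) ≤⟨ 2^-size a b X ⟩
    2 ^ suc (size (num a ∙ num b) + X) ∎
    where
    open ≤-Reasoning
    a = ∣ ↥ p zero ∣
    b = ↧ₙ (p zero)
    X = size (encodeVector (λ s → encodeℚ (p (suc s))))

  numerator-≤ {zero}          p v v≤V = z≤n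
  numerator-≤ {suc n} {V = V} p v v≤V = begin
    a * v zero * denominator (p ∘ suc) + b * numerator (p ∘ suc) (v ∘ suc)
      ≤⟨ +-mono-≤ (*-mono-≤ (*-mono-≤ (<⇒≤ (n<2^bits a)) (v≤V zero)) (denominator-≤ (p ∘ suc)))
                  (*-mono-≤ (<⇒≤ (n<2^bits b)) (numerator-≤ (p ∘ suc) (v ∘ suc) (v≤V ∘ suc))) ⟩
    2 ^ bits a * V * 2 ^ X + 2 ^ bits b * (V * 2 ^ X)
      ≤⟨ +-mono-≤ (*-monoˡ-≤ (2 ^ X) (*-monoˡ-≤ V (^-monoʳ-≤ 2 (m≤m+n (bits a) (bits b)))))
                  (*-monoˡ-≤ (V * 2 ^ X) (^-monoʳ-≤ 2 (m≤n+m (bits b) (bits a)))) ⟩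
    Y * V * 2 ^ X + Y * (V * 2 ^ X)
      ≡⟨ solve 3 (λ y v z → y :* v :* z :+ y :* (v :* z) := v :* (con 2 :* y :* z)) refl Y V (2 ^ X) ⟩
    V * (2 * Y * 2 ^ X)
      ≡⟨ cong (V *_) (^-distribˡ-+-* 2 (suc (bits a + bits b)) X) ⟨
    V * 2 ^ (suc (bits a + bits b) + X)
      ≤⟨ *-monoʳ-≤ V (2^-size a b X) ⟩
    V * 2 ^ suc (size (num a ∙ num b) + X) ∎
    where
    open ≤-Reasoning
    open +-*-Solver
    a = ∣ ↥ p zero ∣
    b = ↧ₙ (p zero)
    X = size (encodeVector (λ s → encodeℚ (p (suc s))))
    Y = 2 ^ (bits a + bits b)

  module _ (f : ℕ → ℕ) (a b W : ℕ) where

    -- With ρ = `a`/`b`, the outer test decides `suc k ≤ ρ * W` without division. The initial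
    -- candidate 0 is always feasible.
    best : ℕ → ℕ
    best zero    = 0
    best (suc k) = ifZero (suc k * b ∸ a * W)
      (ifZero (f (best k) ∸ f (suc k)) (best k) (suc k))
      (best k)

    best-≤ : ∀ k → best k ≤ k
    best-≤ zero    = z≤n
    best-≤ (suc k) with suc k * b ∸ a * W
    ... | suc _ = m≤n⇒m≤1+n (best-≤ k)
    ... | zero with f (best k) ∸ f (suc k)
    ...   | zero  = m≤n⇒m≤1+n (best-≤ k)
    ...   | suc _ = ≤-refl

    best-feasible : ∀ k → best k * b ≤ a * W
    best-feasible zero    = z≤n
    best-feasible (suc k) with suc k * b ∸ a * W in eq
    ... | suc _ = best-feasible k
    ... | zero with f (best k) ∸ f (suc k)
    ...   | zero  = best-feasible k
    ...   | suc _ = m∸n≡0⇒m≤n eq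

    -- A change of candidate only lowers `f`, so smaller `j` stay dominated; for `j = suc k`,
    -- feasibility makes the outer test succeed and the comparison itself gives the bound.
    best-minimal : ∀ k {j} → j ≤ k → j * b ≤ a * W → f (best k) ≤ f j
    best-minimal zero    z≤n _ = ≤-refl
    best-minimal (suc k) {j} j≤k feasible with m≤n⇒m<n∨m≡n j≤k
    best-minimal (suc k) {j} j≤k feasible | inj₁ (s≤s j≤k′) with suc k * b ∸ a * W
    ... | suc _ = best-minimal k j≤k′ feasible
    ... | zero with f (best k) ∸ f (suc k) in eq
    ...   | zero  = best-minimal k j≤k′ feasible
    ...   | suc _ = ≤-trans (<⇒≤ (m∸n≢0⇒n<m λ eq′ → 0≢1+n (trans (sym eq′) eq))) (best-minimal k j≤k′ feasible)
    best-minimal (suc k) j≤k feasible | inj₂ refl rewrite m≤n⇒m∸n≡0 feasible with f (best k) ∸ f (suc k) in eq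
    ... | zero  = m∸n≡0⇒m≤n eq
    ... | suc _ = ≤-refl

  -- The cases match the legal branches over `U`: none, a leaf, or a node. Each carries the evidence
  -- which the corresponding constructors of `Branch` and `Tree` demand.
  data Survey {n C : ℕ} (class : Fin n → Fin C) (U : Subset n) : Set where
    vacant  : Empty U → Survey class U
    uniform : Nonempty U → (γ : Fin C) → (∀ {s} → s ∈ U → class s ≡ γ) → Survey class U
    mixed   : Nonempty U → ¬ (∃[ γ ] ∀ {s} → s ∈ U → class s ≡ γ) → Survey class U

  -- The shift by one separates class 0 from the empty set, and `split` recognises the third case by
  -- its being a pair.
  encodeSurvey : ∀ {n C} {class : Fin n → Fin C} {U} → Survey class U → Value
  encodeSurvey (vacant _)      = num 0
  encodeSurvey (uniform _ γ _) = num (suc (toℕ γ))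
  encodeSurvey (mixed _ _)     = num 0 ∙ num 0

  module _ {n C : ℕ} {class : Fin (suc n) → Fin C} {U : Subset n} where

    skip : Survey (class ∘ suc) U → Survey class (outside ∷ U)
    skip (vacant e)                = vacant λ { (suc s , there s∈U) → e (s , s∈U) }
    skip (uniform (s , s∈U) γ all) = uniform (suc s , there s∈U) γ λ { (there s∈U) → all s∈U }
    skip (mixed (s , s∈U) ¬all)    = mixed (suc s , there s∈U) λ (γ , all) → ¬all (γ , λ s∈U → all (there s∈U))

    extend : Survey (class ∘ suc) U → Survey class (inside ∷ U)
    extend (vacant e) = uniform (zero , here) (class zero) λ where
      here        → refl
      (there s∈U) → contradiction (_ , s∈U) e
    extend (uniform (s , s∈U) γ all) with class zero ≟ γ
    ... | yes eq = uniform (zero , here) γ λ where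
      here        → eq
      (there s∈U) → all s∈U
    ... | no neq = mixed (zero , here) λ (_ , all′) →
      neq (trans (all′ here) (trans (sym (all′ (there s∈U))) (all s∈U)))
    extend (mixed _ ¬all) = mixed (zero , here) λ (γ , all) → ¬all (γ , λ s∈U → all (there s∈U))

  survey : ∀ {n C} (class : Fin n → Fin C) U → Survey class U
  survey class []            = vacant λ ()
  survey class (outside ∷ U) = skip (survey (class ∘ suc) U)
  survey class (inside  ∷ U) = extend (survey (class ∘ suc) U)

  encodeBit : Bool → Value
  encodeBit true  = num 1
  encodeBit false = num 0

  encodeSubset : ∀ {n} → Subset n → Value
  encodeSubset []      = num 0
  encodeSubset (b ∷ U) = encodeBit b ∙ encodeSubset U

  encodeNumbers : ∀ {n} → (Fin n → ℕ) → Value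
  encodeNumbers f = encodeVector (λ i → num (f i))

  -- Time bounds for the list procedures.

  module Basic (N : ℕ) (512≤N : 512 ≤ N) where

    open Levels N 512≤N public
    open Run code N public

    ≤N⇒short : ∀ {n} → n ≤ N → Short N n
    ≤N⇒short {n} n≤N = short (≤-trans (bits≤ n) n≤N)

    ≤⇒short : ∀ {m n} → m ≤ n → Short N n → Short N m
    ≤⇒short m≤n (short n≤) = short (≤-trans (bits-mono m≤n) n≤)

    relax : ∀ {c r B B′} → B ≤ B′ → Fits N c r B → Fits N c r B′
    relax B≤B′ (within h) = within (≤-trans h B≤B′)

    private
      1≤N : Short N 1
      1≤N = ≤N⇒short (≤-trans (s≤s z≤n) 512≤N)

    -- The obligations that `wp` leaves for `differ`, in the order of evaluation.
    differP : ∀ {m n} {A : Set} → Short N m → Short N n → A →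
              Short N m × Short N n × Short N n × Short N m × Short N (m ∸ n) × Short N (n ∸ m) × A
    differP {m} {n} m≤ n≤ a = m≤ , n≤ , n≤ , m≤ ,
      ≤⇒short (m∸n≤m m n) m≤ , ≤⇒short (m∸n≤m n m) n≤ , a

    private
      nth-calls′ : ∀ {n} (f : Fin n → Value) i → n ≤ N →
                   Calls nthᶠ (encodeVector f ∙ encodeFin i) (f i) (n * level 1)
      nth-calls′ f zero _ = calls nthᶠ (return refl (relax (m≤m+n _ _) (fits [])))
      nth-calls′ {suc n} f (suc i) n<N = calls nthᶠ
        (≤N⇒short (≤-trans (<⇒≤ (s≤s (toℕ<n i))) n<N) , 1≤N , _ , _ , nth-calls′ (f ∘ suc) i (<⇒≤ n<N) ,
         return refl (fits-recursion [] []))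

    nth-calls : ∀ {n} (f : Fin n → Value) i → n ≤ N →
                Calls nthᶠ (encodeVector f ∙ encodeFin i) (f i) (level 2)
    nth-calls f i n≤N = weaken (scale n≤N) (nth-calls′ f i n≤N)

    maximum-calls : ∀ {n} (f : Fin n → ℕ) → (∀ i → f i ≤ N) →
                    Calls maximumᶠ (encodeNumbers f) (num (maximum f)) (suc n * level 1)
    maximum-calls {zero}  f f≤N = calls maximumᶠ (return refl (relax (m≤m+n _ _) (fits [])))
    maximum-calls {suc n} f f≤N = calls maximumᶠ
      (_ , _ , maximum-calls (f ∘ suc) (f≤N ∘ suc) ,
       ≤N⇒short (f≤N zero) , m≤N , m≤N , ≤N⇒short (≤-trans (m∸n≤m (f zero) (maximum (f ∘ suc))) (f≤N zero)) ,
       return (cong num (n+[m∸n]≡m⊔n (f zero) _)) (fits-recursion [] []))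
      where m≤N = ≤N⇒short (maximum-≤ (f ∘ suc) (f≤N ∘ suc))

    detour-calls : ∀ {j W d} → j + W ≤ N → d ≤ N →
                   Calls detourᶠ (num d ∙ num j ∙ num W) (num (detour j W d)) (level 1)
    detour-calls {j} {W} {d} j+W≤N d≤N = calls detourᶠ body
      where
      j≤N = ≤N⇒short (m+n≤o⇒m≤o j j+W≤N)
      W≤N = ≤N⇒short (m+n≤o⇒n≤o j j+W≤N)
      body : wp detourᵇ ((num d ∙ num j ∙ num W) ∷ []) 0 [] (Return (num (detour j W d)) (level 1))
      body with d ∸ j
      ... | zero  = ≤N⇒short d≤N , j≤N , return refl (fits [])
      ... | suc _ = ≤N⇒short d≤N , j≤N , j≤N , W≤N , return refl (fits [])

    -- It suffices that the totals are short: every intermediate result is a summand or a factor of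
    -- one of them, and the cofactors dropped are non-zero because they are denominators.
    weigh-calls : ∀ {n} (p : Fin n → ℚ) (d : Fin n → ℕ) {j W} →
                  (∀ s → Short N ∣ ↥ p s ∣) → (∀ s → d s ≤ N) → j + W ≤ N →
                  Short N (numerator p (λ s → detour j W (d s))) → Short N (denominator p) →
                  Calls weighᶠ (encodeVector (λ s → encodeℚ (p s)) ∙ encodeNumbers d ∙ num j ∙ num W)
                    (num (numerator p (λ s → detour j W (d s))) ∙ num (denominator p)) (suc n * level 2)
    weigh-calls {zero}  p d a≤ d≤ j+W≤ n≤ D≤ = calls weighᶠ (return refl (relax (m≤m+n _ _) (fits [])))
    weigh-calls {suc n} p d {j} {W} a≤ d≤ j+W≤ n≤ D≤ = calls weighᶠ
      (_ , _ , weigh-calls (p ∘ suc) (d ∘ suc) (a≤ ∘ suc) (d≤ ∘ suc) j+W≤ n′≤ D′≤ ,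
       _ , _ , detour-calls {j} {W} j+W≤ (d≤ zero) ,
       a≤ zero , ≤N⇒short (≤-trans (detour-≤ j W (d zero)) j+W≤) ,
       ≤⇒short (m≤m*n (a * v) D {{D≢0}}) avD≤ , D′≤ ,
       b≤ , n′≤ , avD≤ , bn≤ , b≤ , D′≤ ,
       return refl (fits-recursion (_ ∷ []) (≤-refl ∷ [])))
      where
      a = ∣ ↥ p zero ∣
      b = ↧ₙ (p zero)
      v = detour j W (d zero)
      D = denominator (p ∘ suc)
      m = numerator (p ∘ suc) (λ s → detour j W (d (suc s)))
      D≢0 : ℕ.NonZero D
      D≢0 = ℕ.>-nonZero (denominator>0 (p ∘ suc))
      avD≤ : Short N (a * v * D)
      avD≤ = ≤⇒short (m≤m+n (a * v * D) (b * m)) n≤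
      bn≤ : Short N (b * m)
      bn≤ = ≤⇒short (m≤n+m (b * m) (a * v * D)) n≤
      n′≤ : Short N m
      n′≤ = ≤⇒short (m≤n*m m b) bn≤
      D′≤ : Short N D
      D′≤ = ≤⇒short (m≤n*m D b) D≤
      b≤ : Short N b
      b≤ = ≤⇒short (m≤m*n b D {{D≢0}}) D≤

    module _ {n} (p : Fin n → ℚ) (d : Fin n → ℕ) {W K a b : ℕ} (n<N : n < N)
             (num≤ : ∀ s → Short N ∣ ↥ p s ∣) (d≤ : ∀ s → d s ≤ N) (K+W≤ : K + W ≤ N)
             (weight≤ : ∀ {j} → j ≤ K → Short N (numerator p (λ s → detour j W (d s))))
             (den≤ : Short N (denominator p))
             (a≤ : Short N a) (b≤ : Short N b) (aW≤ : Short N (a * W)) (Kb≤ : Short N (K * b)) where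

      private
        weight : ℕ → ℕ
        weight j = numerator p (λ s → detour j W (d s))

        j+W≤ : ∀ {j} → j ≤ K → j + W ≤ N
        j+W≤ j≤K = ≤-trans (+-monoˡ-≤ W j≤K) K+W≤

        j-short : ∀ {j} → j ≤ K → Short N j
        j-short {j} j≤K = ≤N⇒short (m+n≤o⇒m≤o j (j+W≤ j≤K))

        W≤ : Short N W
        W≤ = ≤N⇒short (m+n≤o⇒n≤o K K+W≤)

        weight-calls : ∀ {j} → j ≤ K →
          Calls weighᶠ (encodeVector (λ s → encodeℚ (p s)) ∙ encodeNumbers d ∙ num j ∙ num W)
            (num (weight j) ∙ num (denominator p)) (level 3)
        weight-calls j≤K = weaken (scale n<N) (weigh-calls p d num≤ d≤ (j+W≤ j≤K) (weight≤ j≤K) den≤)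

        input : ℕ → Value
        input k = num k ∙ (num a ∙ num b) ∙ encodeVector (λ s → encodeℚ (p s)) ∙ encodeNumbers d ∙ num W

      -- A round weighs at most two cut depths, at `level 3` each, hence one `level 4` per round. As
      -- `K` bounds all depths tried, the same size hypotheses serve every round.
      best-calls : ∀ k → k ≤ K → Calls bestᶠ (input k) (num (best weight a b W k)) (suc k * level 4)
      best-calls zero    _   = calls bestᶠ (return refl (relax (m≤m+n _ _) (fits [])))
      best-calls (suc k) k<K = calls bestᶠ body
        where
        r≤K = ≤-trans (best-≤ weight a b W k) (<⇒≤ k<K)
        kb≤ = ≤⇒short (*-monoˡ-≤ b k<K) Kb≤
        w₁≤ = weight≤ k<K
        w₂≤ = weight≤ r≤K
        c₁ = weight-calls k<K
        c₂ = weight-calls r≤K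
        body : wp bestᵇ (input (suc k) ∷ []) 0 [] (Return (num (best weight a b W (suc k))) (suc (suc k) * level 4))
        body with suc k * b ∸ a * W
        ... | suc _ = j-short k<K , 1≤N , _ , _ , best-calls k (<⇒≤ k<K) ,
          j-short k<K , b≤ , a≤ , W≤ , kb≤ , aW≤ , return refl (fits-recursion [] [])
        ... | zero with weight (best weight a b W k) ∸ weight (suc k) in eq
        ...   | zero = j-short k<K , 1≤N , _ , _ , best-calls k (<⇒≤ k<K) ,
          j-short k<K , b≤ , a≤ , W≤ , kb≤ , aW≤ , _ , _ , c₁ , _ , _ , c₂ , w₂≤ , w₁≤ ,
          if-zero eq (return refl (fits-recursion (_ ∷ _ ∷ []) (≤-refl ∷ ≤-refl ∷ [])))
        ...   | suc _ = j-short k<K , 1≤N , _ , _ , best-calls k (<⇒≤ k<K) ,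
          j-short k<K , b≤ , a≤ , W≤ , kb≤ , aW≤ , _ , _ , c₁ , _ , _ , c₂ , w₂≤ , w₁≤ ,
          if-nonzero (λ eq′ → 0≢1+n (trans (sym eq′) eq)) (return refl (fits-recursion (_ ∷ _ ∷ []) (≤-refl ∷ ≤-refl ∷ [])))

    all-calls : ∀ {n} (f : Fin n → Value) → Calls allᶠ (encodeVector f) (encodeSubset (⊤ {n})) (suc n * level 1)
    all-calls {zero}  f = calls allᶠ (return refl (relax (m≤m+n _ _) (fits [])))
    all-calls {suc n} f = calls allᶠ (_ , _ , all-calls (f ∘ suc) , return refl (fits-recursion [] []))

    select-calls : ∀ {n ℓ} (r : Fin n → Fin ℓ) (U : Subset n) (i : Fin ℓ) → (∀ (i : Fin ℓ) → Short N (toℕ i)) →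
      Calls selectᶠ (encodeVector (λ s → encodeFin (r s)) ∙ encodeSubset U ∙ encodeFin i)
        (encodeSubset (U ∩ Vec.tabulate (λ s → does (r s ≟ i)))) (suc n * level 1)
    select-calls r []            i ℓ≤ = calls selectᶠ (return refl (relax (m≤m+n _ _) (fits [])))
    select-calls r (outside ∷ U) i ℓ≤ = calls selectᶠ
      (_ , _ , select-calls (r ∘ suc) U i ℓ≤ , return refl (fits-recursion [] []))
    select-calls r (inside ∷ U)  i ℓ≤ with r zero ≟ i
    ... | yes refl = calls selectᶠ
      (_ , _ , select-calls (r ∘ suc) U i ℓ≤ , differP (ℓ≤ i) (ℓ≤ i)
      (if-zero (distance-refl (toℕ i)) (return refl (fits-recursion [] []))))
    ... | no r≢i = calls selectᶠ
      (_ , _ , select-calls (r ∘ suc) U i ℓ≤ , differP (ℓ≤ (r zero)) (ℓ≤ i)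
      (if-nonzero (distance-≢ (r≢i ∘ toℕ-injective)) (return refl (fits-recursion [] []))))

    survey-calls : ∀ {n C} (class : Fin n → Fin C) (U : Subset n) → (∀ (γ : Fin C) → Short N (suc (toℕ γ))) →
      Calls surveyᶠ (encodeVector (λ s → encodeFin (class s)) ∙ encodeSubset U)
        (encodeSurvey (survey class U)) (suc n * level 1)
    survey-calls class []            C≤ = calls surveyᶠ (return refl (relax (m≤m+n _ _) (fits [])))
    survey-calls class (outside ∷ U) C≤ with survey (class ∘ suc) U | survey-calls (class ∘ suc) U C≤
    ... | vacant _      | h = calls surveyᶠ (_ , _ , h , return refl (fits-recursion [] []))
    ... | uniform _ _ _ | h = calls surveyᶠ (_ , _ , h , return refl (fits-recursion [] []))
    ... | mixed _ _     | h = calls surveyᶠ (_ , _ , h , return refl (fits-recursion [] []))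
    survey-calls class (inside ∷ U)  C≤ with survey (class ∘ suc) U | survey-calls (class ∘ suc) U C≤
    ... | vacant _      | h = calls surveyᶠ (_ , _ , h , 1≤N , c≤ , return refl (fits-recursion [] []))
      where c≤ = ≤⇒short (n≤1+n (toℕ (class zero))) (C≤ (class zero))
    ... | mixed _ _     | h = calls surveyᶠ (_ , _ , h , return refl (fits-recursion [] []))
    ... | uniform _ γ _ | h with class zero ≟ γ
    ...   | yes refl = calls surveyᶠ (_ , _ , h , 1≤N , c≤ , C≤ γ , C≤ γ , 1≤N , c≤ , C≤ γ , C≤ γ ,
          ≤⇒short (m∸n≤m (toℕ γ) (toℕ γ)) c≤ , ≤⇒short (m∸n≤m (toℕ γ) (toℕ γ)) c≤ ,
          if-zero (distance-refl (toℕ γ)) (return refl (fits-recursion [] [])))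
      where c≤ = ≤⇒short (n≤1+n (toℕ γ)) (C≤ γ)
    ...   | no c≢γ = calls surveyᶠ (_ , _ , h , 1≤N , c≤ , C≤ γ , C≤ c , 1≤N , c≤ , C≤ c , C≤ γ ,
          ≤⇒short (m∸n≤m (toℕ γ) (toℕ c)) γ≤ , ≤⇒short (m∸n≤m (toℕ c) (toℕ γ)) c≤ ,
          if-nonzero (distance-≢ (c≢γ ∘ sym ∘ toℕ-injective)) (return refl (fits-recursion [] [])))
      where
      c = class zero
      c≤ = ≤⇒short (n≤1+n (toℕ c)) (C≤ c)
      γ≤ = ≤⇒short (n≤1+n (toℕ γ)) (C≤ γ)

-- Cutting and restricting trees.

module Pruning where

  open Evaluation
  open Algorithm
  open Procedures
  open import Data.Nat.Base as ℕ using (ℕ; zero; suc; _+_; _*_; _≤_; _<_; z≤n; s≤s)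
  open import Data.Nat.Properties as ℕ hiding (_≟_; suc-injective)
  open import Data.Fin.Base using (Fin; zero; suc; toℕ)
  open import Data.Fin.Properties using (_≟_; toℕ<n; toℕ-injective; suc-injective)
  open import Data.Fin.Subset using (Subset; _∈_; _⊆_; _∩_; ⊤)
  open import Data.Fin.Subset.Properties using (x∈p∩q⁺; x∈p∩q⁻; ⊆-max; ⊆-refl; ∈⊤)
  open import Data.List.Base as List using (List; []; _∷_; concat; length)
  open import Data.List.Relation.Unary.All using ([]; _∷_)
  open import Data.Vec.Base as Vec using ([]; _∷_)
  open import Data.Vec.Properties using (lookup∘tabulate; lookup⇒[]=)
  open import Data.Unit.Base using () renaming (⊤ to Unit)
  open import Data.Product.Base using (∃-syntax; _,_)
  open import Function.Base using (_∘_; id)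
  open import Relation.Nullary.Decidable using (dec-true)
  open import Relation.Nullary.Negation using (¬_; contradiction)
  open import Relation.Binary.PropositionalEquality.Core using (_≡_; _≢_; refl; sym; trans; subst)

  length≤size : ∀ vs → length vs ≤ size (encodeList vs)
  length≤size []       = z≤n
  length≤size (v ∷ vs) = s≤s (≤-trans (length≤size vs) (m≤n+m _ (size v)))

  module Trees (I : DFEP) where
    open DFEP I

    -- Outcomes are reached through `key`, so that an induction can drop the first one; `key = id`
    -- gives the children in `encodeTree`.
    encodeBranches : ∀ {k} {Us : Fin k → Subset #objects} → (Fin k → Outcome) → (∀ i → Branch I (Us i)) → List Value
    encodeBranches key bs = concat (List.tabulate λ i → encodeBranch (key i) (bs i))

    size-child : ∀ {k} {Us : Fin k → Subset #objects} (key : Fin k → Outcome) (bs : ∀ i → Branch I (Us i)) i {ne D} →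
                 bs i ≡ child ne D → size (encodeTree D) ≤ size (encodeList (encodeBranches key bs))
    size-child key bs zero {D = D} eq rewrite eq =
      m≤n⇒m≤1+n (≤-trans (m≤n⇒m≤1+n (m≤n+m _ (size (encodeFin (key zero))))) (m≤m+n _ _))
    size-child key bs (suc i) eq with bs zero
    ... | none _    = size-child (key ∘ suc) (bs ∘ suc) i eq
    ... | child _ _ = m≤n⇒m≤1+n (≤-trans (size-child (key ∘ suc) (bs ∘ suc) i eq) (m≤n+m _ _))

    size-children : ∀ {U} t ¬all (bs : ∀ i → Branch I (outcomeSet I U t i)) →
                    suc (size (encodeList (encodeBranches id bs))) ≤ size (encodeTree {I} (node t ¬all bs))
    size-children t ¬all bs = s≤s (≤-trans (m≤n⇒m≤1+n (m≤n+m _ (size (encodeFin t)))) (m≤n+m _ (size (num 1))))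

    ∈-outcomeSet : ∀ {U s} t → s ∈ U → s ∈ outcomeSet I U t (test t s)
    ∈-outcomeSet {s = s} t s∈U = x∈p∩q⁺ (s∈U , lookup⇒[]= s _
      (trans (lookup∘tabulate _ s) (dec-true (test t s ≟ test t s) refl)))

    outcomeSet-⊆ : ∀ {U V} t i → U ⊆ V → outcomeSet I U t i ⊆ outcomeSet I V t i
    outcomeSet-⊆ {U} t i U⊆V s∈ with x∈p∩q⁻ U _ s∈
    ... | s∈U , s∈i = x∈p∩q⁺ (U⊆V s∈U , s∈i)

    -- Every node on the path adds at least one to the encoding. With unit costs, depths and heights
    -- are therefore polynomially bounded by value.
    cost≤size : UnitCost I → ∀ {U} (T : Tree I U) s → cost T s ≤ size (encodeTree T)
    cost≤size unit (leaf γ all)     s = z≤n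
    cost≤size unit (node t ¬all bs) s rewrite unit t with bs (test t s) in eq
    ... | none _     = ≤-trans (s≤s z≤n) (size-children t ¬all bs)
    ... | child ne D = ≤-trans (s≤s (≤-trans (cost≤size unit D s) (size-child id bs (test t s) eq))) (size-children t ¬all bs)

    module _ (D-W : DecisionTree I) where

      mutual
        -- In mode 0, restrict a tree to U; in mode 1 + j, also switch to D-W,
        -- in mode 0, at the nodes of depth j.
        prune : ∀ {U V} → ℕ → Tree I V → U ⊆ V → Survey class U → Branch I U
        prune m T U⊆V (vacant e)         = none e
        prune m T U⊆V (uniform ne γ all) = child ne (leaf γ all)
        prune m (leaf γ all) U⊆V (mixed ne ¬all) = contradiction (γ , λ {_} s∈U → all (U⊆V s∈U)) ¬all
        prune zero          (node t _ bs) U⊆V (mixed ne ¬all) = child ne (node t ¬all (pruneBranches zero t bs U⊆V))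
        -- `D-W` is no subterm of the tree at hand; the recursion is well founded because the mode
        -- drops to 0.
        prune (suc zero)    (node _ _ _)  U⊆V (mixed ne ¬all) = prune 0 D-W (⊆-max _) (mixed ne ¬all)
        prune (suc (suc j)) (node t _ bs) U⊆V (mixed ne ¬all) = child ne (node t ¬all (pruneBranches (suc j) t bs U⊆V))

        pruneBranches : ∀ {U V} → ℕ → ∀ t → (∀ i → Branch I (outcomeSet I V t i)) → U ⊆ V →
                        ∀ i → Branch I (outcomeSet I U t i)
        pruneBranches m t bs U⊆V i = pruneBranch m (bs i) (outcomeSet-⊆ t i U⊆V) (survey class _)

        pruneBranch : ∀ {U V} → ℕ → Branch I V → U ⊆ V → Survey class U → Branch I U
        pruneBranch m (none e)    U⊆V sv = none λ (s , s∈U) → e (s , U⊆V s∈U)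
        pruneBranch m (child _ T) U⊆V sv = prune m T U⊆V sv

      module _ (unit : UnitCost I) where

        mutual
          prune-cost₀ : ∀ {U V} (T : Tree I V) (U⊆V : U ⊆ V) sv s → branchCost (prune 0 T U⊆V sv) s ≤ cost T s
          prune-cost₀ T             U⊆V (vacant _)      s = z≤n
          prune-cost₀ T             U⊆V (uniform _ _ _) s = z≤n
          prune-cost₀ (leaf γ all)  U⊆V (mixed _ ¬all)  s = contradiction (γ , λ {_} s∈U → all (U⊆V s∈U)) ¬all
          prune-cost₀ (node t _ bs) U⊆V (mixed _ _)     s =
            +-monoʳ-≤ (c t) (pruneBranch-cost₀ (bs (test t s)) (outcomeSet-⊆ t (test t s) U⊆V) (survey class _) s)

          pruneBranch-cost₀ : ∀ {U V} (b : Branch I V) (U⊆V : U ⊆ V) sv s →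
                              branchCost (pruneBranch 0 b U⊆V sv) s ≤ branchCost b s
          pruneBranch-cost₀ (none _)    U⊆V sv s = z≤n
          pruneBranch-cost₀ (child _ T) U⊆V sv s = prune-cost₀ T U⊆V sv s

        module _ {W} (D-W≤ : ∀ s → cost D-W s ≤ W) where

          mutual
            -- Above the cut, a node costs one test and lowers `j` by one, which is `detour-suc`.
            -- Missing branches cost 0, so the bound holds for every `s`, whether or not it lies in
            -- `U`.
            prune-cost : ∀ {U V} j (T : Tree I V) (U⊆V : U ⊆ V) sv s →
                         branchCost (prune (suc j) T U⊆V sv) s ≤ detour j W (cost T s)
            prune-cost j       T             U⊆V (vacant _)      s = z≤n
            prune-cost j       T             U⊆V (uniform _ _ _) s = z≤n
            prune-cost j       (leaf γ all)  U⊆V (mixed _ ¬all)  s = contradiction (γ , λ {_} s∈U → all (U⊆V s∈U)) ¬all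
            -- By `unit t` the old cost is a successor, so `detour zero W` evaluates to `W`.
            prune-cost zero    (node t _ bs) U⊆V (mixed ne ¬all) s rewrite unit t =
              ≤-trans (prune-cost₀ D-W (⊆-max _) (mixed ne ¬all) s) (D-W≤ s)
            prune-cost (suc j) (node t _ bs) U⊆V (mixed _ _)     s rewrite unit t = begin
              suc (branchCost (pruneBranches (suc j) t bs U⊆V (test t s)) s) ≤⟨ s≤s (pruneBranch-cost j (bs (test t s)) _ _ s) ⟩
              suc (detour j W (branchCost (bs (test t s)) s))                ≡⟨ detour-suc j W _ ⟩
              detour (suc j) W (suc (branchCost (bs (test t s)) s))          ∎
              where open ≤-Reasoning

            pruneBranch-cost : ∀ {U V} j (b : Branch I V) (U⊆V : U ⊆ V) sv s →
                               branchCost (pruneBranch (suc j) b U⊆V sv) s ≤ detour j W (branchCost b s)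
            pruneBranch-cost j (none _)    U⊆V sv s = z≤n
            pruneBranch-cost j (child _ T) U⊆V sv s = prune-cost j T U⊆V sv s

    encodePruned : ∀ {U} → Branch I U → Value
    encodePruned (none _)    = num 0
    encodePruned (child _ D) = encodeTree D ∙ num 0

    classesᵛ testsᵛ : Value
    classesᵛ = encodeVector (λ s → encodeFin (class s))
    testsᵛ   = encodeVector (λ t → encodeVector (λ s → encodeFin (test t s)))

    -- Time bounds for the procedures on trees.

    module Specification (N : ℕ) (512≤N : 512 ≤ N) (unit : UnitCost I)
      (objects<N : #objects < N) (tests≤N : #tests ≤ N)
      (classes-short : Short N #classes) (outcomes-short : Short N ℓ) where

      open Basic N 512≤N public

      private
        outcome-short : ∀ (i : Outcome) → Short N (toℕ i)
        outcome-short i = ≤⇒short (<⇒≤ (toℕ<n i)) outcomes-short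

        1-short : Short N 1
        1-short = ≤N⇒short (≤-trans (s≤s z≤n) 512≤N)

        -- Injectivity of `key` ensures that no entry before that of `i` matches.
        assoc-calls′ : ∀ {k} {Us : Fin k → Subset #objects} (key : Fin k → Outcome) (bs : ∀ i → Branch I (Us i)) i {ne D} →
          (∀ {i j} → key i ≡ key j → i ≡ j) → bs i ≡ child ne D →
          Calls assocᶠ (encodeList (encodeBranches key bs) ∙ encodeFin (key i)) (encodeTree D)
            (length (encodeBranches key bs) * level 1)
        assoc-calls′ key bs zero inj eq rewrite eq = calls assocᶠ
          (differP (outcome-short (key zero)) (outcome-short (key zero))
            (if-zero (distance-refl (toℕ (key zero))) (return refl (relax (m≤m+n _ _) (fits [])))))
        assoc-calls′ key bs (suc i) inj eq with bs zero
        ... | none _    = assoc-calls′ (key ∘ suc) (bs ∘ suc) i (suc-injective ∘ inj) eq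
        ... | child _ _ = calls assocᶠ
          (differP (outcome-short (key zero)) (outcome-short (key (suc i)))
            (if-nonzero (distance-≢ (key₀≢ ∘ toℕ-injective))
              (_ , _ , assoc-calls′ (key ∘ suc) (bs ∘ suc) i (suc-injective ∘ inj) eq , return refl (fits-recursion [] []))))
          where
          key₀≢ : key zero ≢ key (suc i)
          key₀≢ eq′ with () ← inj eq′

      assoc-calls : ∀ {U} t ¬all (bs : ∀ i → Branch I (outcomeSet I U t i)) i {ne D} →
        bs i ≡ child ne D → size (encodeTree {I} (node t ¬all bs)) ≤ N →
        Calls assocᶠ (encodeList (encodeBranches id bs) ∙ encodeFin i) (encodeTree D) (level 2)
      assoc-calls t ¬all bs i eq size≤N = weaken (scale (begin
        length (encodeBranches id bs)            ≤⟨ length≤size _ ⟩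
        size (encodeList (encodeBranches id bs)) ≤⟨ n≤1+n _ ⟩
        suc (size (encodeList (encodeBranches id bs))) ≤⟨ size-children t ¬all bs ⟩
        size (encodeTree {I} (node t ¬all bs))   ≤⟨ size≤N ⟩
        N ∎)) (assoc-calls′ id bs i id eq)
        where open ≤-Reasoning

      private
        depth-calls′ : ∀ {U} (T : Tree I U) s → s ∈ U → size (encodeTree T) ≤ N →
          Calls depthᶠ (testsᵛ ∙ encodeTree T ∙ encodeFin s) (num (cost T s)) (suc (cost T s) * level 3)
        depth-calls′ (leaf γ all)     s s∈U size≤N = calls depthᶠ (return refl (relax (≤-trans (level-mono (s≤s z≤n)) (m≤m+n _ _)) (fits {e = 0} [])))
        depth-calls′ (node t ¬all bs) s s∈U size≤N rewrite unit t with bs (test t s) in eq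
        ... | none e     = contradiction (s , ∈-outcomeSet t s∈U) e
        ... | child ne D = calls depthᶠ
          (_ , _ , nth-calls _ t tests≤N ,
           _ , _ , nth-calls _ s (<⇒≤ objects<N) ,
           _ , _ , assoc-calls t ¬all bs (test t s) eq size≤N ,
           _ , _ , depth-calls′ D s (∈-outcomeSet t s∈U) D≤N ,
           1-short , ≤N⇒short (≤-trans (cost≤size unit D s) D≤N) ,
           return refl (fits-recursion [] (≤-refl ∷ ≤-refl ∷ ≤-refl ∷ [])))
          where
          D≤N : size (encodeTree D) ≤ N
          D≤N = ≤-trans (size-child id bs (test t s) eq) (≤-trans (<⇒≤ (size-children t ¬all bs)) size≤N)

      module _ (D : DecisionTree I) (size<N : size (encodeTree D) < N) where

        depth-calls : ∀ s → Calls depthᶠ (testsᵛ ∙ encodeTree D ∙ encodeFin s) (num (cost D s)) (level 4)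
        depth-calls s = weaken (scale (≤-<-trans (cost≤size unit D s) size<N)) (depth-calls′ D s ∈⊤ (<⇒≤ size<N))

        private
          -- The program counts objects by a number `s`; `idx` translates the remaining positions
          -- back to objects, so that the induction can run over a suffix.
          depths-calls′ : ∀ {k} (vs : Fin k → Value) (idx : Fin k → Object) s → (∀ i → toℕ (idx i) ≡ s + toℕ i) →
            Calls depthsᶠ (testsᵛ ∙ encodeTree D ∙ num s ∙ encodeVector vs) (encodeNumbers (cost D ∘ idx)) (suc k * level 5)
          depths-calls′ {zero}  vs idx s eq = calls depthsᶠ (return refl (relax (≤-trans (level-mono (s≤s z≤n)) (m≤m+n _ _)) (fits {e = 0} [])))
          depths-calls′ {suc k} vs idx s eq = calls depthsᶠ
            (_ , _ , subst (λ s → Calls depthᶠ (testsᵛ ∙ encodeTree D ∙ num s) _ _) idx₀≡s (depth-calls (idx zero)) ,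
             1-short , s-short ,
             _ , _ , depths-calls′ (vs ∘ suc) (idx ∘ suc) (suc s) (λ i → trans (eq (suc i)) (+-suc s (toℕ i))) ,
             return refl (fits-recursion [] (≤-refl ∷ [])))
            where
            idx₀≡s : toℕ (idx zero) ≡ s
            idx₀≡s = trans (eq zero) (+-identityʳ s)
            s-short : Short N s
            s-short = ≤N⇒short (≤-trans (≤-reflexive (sym idx₀≡s)) (<⇒≤ (<-trans (toℕ<n (idx zero)) objects<N)))

        depths-calls : (vs : Object → Value) →
          Calls depthsᶠ (testsᵛ ∙ encodeTree D ∙ num 0 ∙ encodeVector vs) (encodeNumbers (cost D)) (level 6)
        depths-calls vs = weaken (scale objects<N) (depths-calls′ vs id 0 (λ _ → refl))

      module _ (D-W : DecisionTree I) (size≤N : size (encodeTree D-W) ≤ N) where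

        private
          -- The time allowed per unit of size of the tree. In a positive mode a single node may
          -- trigger a whole restriction of `D-W`, worth up to `N * level 3`, that is `level 4`; its
          -- caller then needs `level 5`.
          chunk : ℕ → ℕ
          chunk zero    = level 3
          chunk (suc _) = level 5

          level3≤chunk : ∀ m → level 3 ≤ chunk m
          level3≤chunk zero    = ≤-refl
          level3≤chunk (suc m) = level-mono (s≤s (s≤s (s≤s z≤n)))

          fit : ∀ m a b i → level 3 + (a * chunk m + b * chunk m) ≤ suc (suc (i + a) + b) * chunk m
          fit m a b i = begin
            level 3 + (a * chunk m + b * chunk m) ≤⟨ +-mono-≤ (level3≤chunk m) (≤-reflexive (sym (*-distribʳ-+ (chunk m) a b))) ⟩
            suc (a + b) * chunk m                 ≤⟨ *-monoˡ-≤ (chunk m) (s≤s (+-monoˡ-≤ b (m≤n⇒m≤1+n (m≤n+m a i)))) ⟩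
            suc (suc (i + a) + b) * chunk m       ∎
            where open ≤-Reasoning

          ctx : Value
          ctx = classesᵛ ∙ testsᵛ ∙ encodeTree D-W

          PruneCalls : ∀ {U V} → ℕ → (T : Tree I V) → U ⊆ V → Survey class U → Set
          PruneCalls {U} m T U⊆V sv = Calls pruneᶠ (ctx ∙ num m ∙ encodeSubset U ∙ encodeTree T)
            (encodePruned (prune D-W m T U⊆V sv)) (size (encodeTree T) * chunk m)

          BranchCalls : ∀ {U V} → ℕ → Branch I V → U ⊆ V → Survey class U → Set
          BranchCalls m (none _)    U⊆V sv = Unit
          BranchCalls m (child _ T) U⊆V sv = PruneCalls m T U⊆V sv

          survey-class-calls : ∀ U → Calls surveyᶠ (classesᵛ ∙ encodeSubset U) (encodeSurvey (survey class U)) (level 2)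
          survey-class-calls U = weaken (scale objects<N)
            (survey-calls class U λ γ → ≤⇒short (toℕ<n γ) classes-short)

          -- The calls for the children come in as `ih`, which keeps this induction on `k` apart
          -- from the structural recursion on trees in `prune-calls`.
          pruneList-calls : ∀ {U V} m t (U⊆V : U ⊆ V) {k} (key : Fin k → Outcome)
            (bs : ∀ i → Branch I (outcomeSet I V t (key i))) →
            (∀ i → BranchCalls m (bs i) (outcomeSet-⊆ t (key i) U⊆V) (survey class _)) →
            Calls pruneListᶠ
              (ctx ∙ num m ∙ encodeSubset U ∙ encodeVector (λ s → encodeFin (test t s)) ∙ encodeList (encodeBranches key bs))
              (encodeList (encodeBranches key λ i → pruneBranch D-W m (bs i) (outcomeSet-⊆ t (key i) U⊆V) (survey class _)))
              (size (encodeList (encodeBranches key bs)) * chunk m)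
          pruneList-calls m t U⊆V {zero} key bs ih =
            calls pruneListᶠ (return refl (relax (≤-trans (level-mono (s≤s z≤n)) (≤-trans (level3≤chunk m) (m≤m+n _ _))) (fits {e = 0} [])))
          pruneList-calls {U} m t U⊆V {suc k} key bs ih with bs zero | ih zero | pruneList-calls m t U⊆V (key ∘ suc) (bs ∘ suc) (ih ∘ suc)
          ... | none _    | _   | rest = rest
          ... | child _ T | h | rest
            with prune D-W m T (outcomeSet-⊆ t (key zero) U⊆V) (survey class (outcomeSet I U t (key zero))) | h
          ... | none _    | h = calls pruneListᶠ
                (_ , _ , rest , _ , _ , weaken (scale objects<N) (select-calls (test t) U (key zero) outcome-short) , _ , _ , h ,
                 return refl (relax (fit m (size (encodeTree T)) _ (size (encodeFin (key zero)))) (fits-recursion₂ ≤-refl)))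
          ... | child _ _ | h = calls pruneListᶠ
                (_ , _ , rest , _ , _ , weaken (scale objects<N) (select-calls (test t) U (key zero) outcome-short) , _ , _ , h ,
                 return refl (relax (fit m (size (encodeTree T)) _ (size (encodeFin (key zero)))) (fits-recursion₂ ≤-refl)))

          fit-node : ∀ {V} m t ¬all (bs : ∀ i → Branch I (outcomeSet I V t i)) →
            level 3 + size (encodeList (encodeBranches id bs)) * chunk m ≤ size (encodeTree {I} (node t ¬all bs)) * chunk m
          fit-node m t ¬all bs = ≤-trans (+-monoˡ-≤ _ (level3≤chunk m)) (*-monoˡ-≤ (chunk m) (size-children t ¬all bs))

          fit-3 : ∀ {V} m (T : Tree I V) → level 3 ≤ size (encodeTree T) * chunk m
          fit-3 m T = ≤-trans (level3≤chunk m) (m≤n*m (chunk m) (size (encodeTree T)) {{size≢0}})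
            where
            size≢0 : ℕ.NonZero (size (encodeTree T))
            size≢0 with encodeTree T
            ... | num _ = _
            ... | _ ∙ _ = _

        mutual
          -- `sv` is an arbitrary survey whose code the program returns, so it can be matched on; at
          -- a cut, the same evidence is handed on to the restriction of `D-W`.
          prune-calls : ∀ {U V} m (T : Tree I V) (U⊆V : U ⊆ V) sv → m ≤ N →
            Calls surveyᶠ (classesᵛ ∙ encodeSubset U) (encodeSurvey sv) (level 2) → PruneCalls m T U⊆V sv
          prune-calls m T U⊆V (vacant e)         m≤N h = calls pruneᶠ (_ , _ , h , return refl (relax (fit-3 m T) (fits (≤-refl ∷ []))))
          prune-calls m T U⊆V (uniform ne γ all) m≤N h = calls pruneᶠ
            (_ , _ , h , ≤⇒short (toℕ<n γ) classes-short , 1-short , return refl (relax (fit-3 m T) (fits (≤-refl ∷ []))))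
          prune-calls m (leaf γ all) U⊆V (mixed ne ¬all) m≤N h = contradiction (γ , λ {_} s∈U → all (U⊆V s∈U)) ¬all
          prune-calls zero (node t ¬allV bs) U⊆V (mixed ne ¬all) m≤N h = calls pruneᶠ
            (_ , _ , h , differP (≤N⇒short m≤N) 1-short
            (≤N⇒short m≤N , 1-short , _ , _ , nth-calls _ t tests≤N ,
             _ , _ , pruneList-calls zero t U⊆V id bs (λ i → branch-calls zero (bs i) _ _ m≤N (survey-class-calls _)) ,
             return refl (relax (fit-node zero t ¬allV bs) (fits-recursion [] (≤-refl ∷ ≤-refl ∷ [])))))
          prune-calls (suc zero) T@(node t ¬allV bs) U⊆V (mixed ne ¬all) m≤N h = calls pruneᶠ
            (_ , _ , h , differP (≤N⇒short m≤N) 1-short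
            (_ , _ , weaken (scale size≤N) (prune-calls zero D-W (⊆-max _) (mixed ne ¬all) z≤n h) ,
             return refl (relax fit-5 (fits (≤-refl ∷ level-mono (s≤s (s≤s z≤n)) ∷ [])))))
            where
            fit-5 = m≤n*m (level 5) (size (encodeTree T))
          prune-calls (suc (suc j)) (node t ¬allV bs) U⊆V (mixed ne ¬all) m≤N h = calls pruneᶠ
            (_ , _ , h , differP (≤N⇒short m≤N) 1-short
            (≤N⇒short m≤N , 1-short , _ , _ , nth-calls _ t tests≤N ,
             _ , _ , pruneList-calls (suc j) t U⊆V id bs (λ i → branch-calls (suc j) (bs i) _ _ (<⇒≤ m≤N) (survey-class-calls _)) ,
             return refl (relax (fit-node (suc j) t ¬allV bs) (fits-recursion [] (≤-refl ∷ ≤-refl ∷ [])))))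

          private
            branch-calls : ∀ {U V} m (b : Branch I V) (U⊆V : U ⊆ V) sv → m ≤ N →
              Calls surveyᶠ (classesᵛ ∙ encodeSubset U) (encodeSurvey sv) (level 2) → BranchCalls m b U⊆V sv
            branch-calls m (none _)    U⊆V sv m≤N h = _
            branch-calls m (child _ T) U⊆V sv m≤N h = prune-calls m T U⊆V sv m≤N h

        cut-calls : ∀ j (D-E : DecisionTree I) → size (encodeTree D-E) ≤ N → j < N →
          Calls pruneᶠ (ctx ∙ num (suc j) ∙ encodeSubset (⊤ {#objects}) ∙ encodeTree D-E)
            (encodePruned (prune D-W (suc j) D-E ⊆-refl (survey class ⊤))) (level 6)
        cut-calls j D-E size≤N′ j<N = weaken (scale size≤N′)
          (prune-calls (suc j) D-E ⊆-refl (survey class ⊤) j<N (survey-class-calls ⊤))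

-- The trade-off between height and expected cost, over the integers.

module TradeOff where

  open Procedures hiding (module Basic)
  open import Data.Nat.Base as ℕ using (ℕ; zero; suc; _+_; _*_; _^_; _∸_; _⊓_; _≤_; _<_; z≤n)
  open import Data.Nat.Properties as ℕ
  open import Data.Nat.Solver using (module +-*-Solver)
  open import Data.Integer.Base using (∣_∣)
  open import Data.Rational.Base using (ℚ; ↥_; ↧ₙ_)
  open import Data.Fin.Base using (Fin; zero; suc)
  open import Relation.Nullary.Negation using (contradiction)
  open import Function.Base using (_∘_)
  open import Relation.Binary.PropositionalEquality.Core using (_≡_; refl; sym; trans; cong)
  open +-*-Solver

  numerator-mono : ∀ {n} (p : Fin n → ℚ) {u v : Fin n → ℕ} → (∀ s → u s ≤ v s) → numerator p u ≤ numerator p v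
  numerator-mono {zero}  p u≤v = z≤n
  numerator-mono {suc n} p u≤v = +-mono-≤
    (*-monoˡ-≤ (denominator (p ∘ suc)) (*-monoʳ-≤ ∣ ↥ p zero ∣ (u≤v zero)))
    (*-monoʳ-≤ (↧ₙ (p zero)) (numerator-mono (p ∘ suc) (u≤v ∘ suc)))

  numerator-cong : ∀ {n} (p : Fin n → ℚ) {u v : Fin n → ℕ} → (∀ s → u s ≡ v s) → numerator p u ≡ numerator p v
  numerator-cong p u≡v = ≤-antisym (numerator-mono p (≤-reflexive ∘ u≡v)) (numerator-mono p (≤-reflexive ∘ sym ∘ u≡v))

  numerator-+ : ∀ {n} (p : Fin n → ℚ) (u v : Fin n → ℕ) →
                numerator p (λ s → u s + v s) ≡ numerator p u + numerator p v
  numerator-+ {zero}  p u v = refl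
  numerator-+ {suc n} p u v rewrite numerator-+ (p ∘ suc) (u ∘ suc) (v ∘ suc) =
    solve 7 (λ a b D x y m k → a :* (x :+ y) :* D :+ b :* (m :+ k) := (a :* x :* D :+ b :* m) :+ (a :* y :* D :+ b :* k)) refl
      (∣ ↥ p zero ∣) (↧ₙ (p zero)) (denominator (p ∘ suc)) (u zero) (v zero)
      (numerator (p ∘ suc) (u ∘ suc)) (numerator (p ∘ suc) (v ∘ suc))

  numerator-* : ∀ {n} (p : Fin n → ℚ) k (v : Fin n → ℕ) → numerator p (λ s → k * v s) ≡ k * numerator p v
  numerator-* {zero}  p k v = sym (*-zeroʳ k)
  numerator-* {suc n} p k v rewrite numerator-* (p ∘ suc) k (v ∘ suc) =
    solve 6 (λ a b D x m k → a :* (k :* x) :* D :+ b :* (k :* m) := k :* (a :* x :* D :+ b :* m)) refl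
      (∣ ↥ p zero ∣) (↧ₙ (p zero)) (denominator (p ∘ suc)) (v zero) (numerator (p ∘ suc) (v ∘ suc)) k

  module _ (A Q : ℕ → ℕ) (w M : ℕ) (A₀ : A 0 ≡ 0) (A-suc : ∀ j → A (suc j) ≡ A j + Q j) where

    -- The factor `w / suc w` per step, with powers of `suc w` multiplied across to stay within the
    -- naturals.
    geometric-decay : ∀ i → (∀ j → j < i → M ≤ A j + suc w * Q j) →
                      suc w ^ i * (M ∸ A i) ≤ w ^ i * M
    geometric-decay zero    _ = *-monoʳ-≤ 1 (m∸n≤m M (A 0))
    geometric-decay (suc i) h = begin
      suc w * suc w ^ i * (M ∸ A (suc i))   ≡⟨ solve 3 (λ a b c → a :* b :* c := b :* (a :* c)) refl (suc w) (suc w ^ i) (M ∸ A (suc i)) ⟩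
      suc w ^ i * (suc w * (M ∸ A (suc i))) ≤⟨ *-monoʳ-≤ (suc w ^ i) step ⟩
      suc w ^ i * (w * (M ∸ A i))           ≡⟨ solve 3 (λ a b c → b :* (a :* c) := a :* (b :* c)) refl w (suc w ^ i) (M ∸ A i) ⟩
      w * (suc w ^ i * (M ∸ A i))           ≤⟨ *-monoʳ-≤ w (geometric-decay i λ j j<i → h j (m≤n⇒m≤1+n j<i)) ⟩
      w * (w ^ i * M)                       ≡⟨ *-assoc w (w ^ i) M ⟨
      w * w ^ i * M                         ∎
      where
      open ≤-Reasoning
      G = M ∸ A i
      step : suc w * (M ∸ A (suc i)) ≤ w * G
      step = begin
        suc w * (M ∸ A (suc i))     ≡⟨ cong (λ a → suc w * (M ∸ a)) (A-suc i) ⟩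
        suc w * (M ∸ (A i + Q i))   ≡⟨ cong (suc w *_) (∸-+-assoc M (A i) (Q i)) ⟨
        suc w * (G ∸ Q i)           ≡⟨ *-distribˡ-∸ (suc w) G (Q i) ⟩
        -- `h i` says that the gap `G` is at most `suc w * Q i`, so at least one of the `suc w`
        -- copies of `G` disappears.
        suc w * G ∸ suc w * Q i     ≤⟨ ∸-monoʳ-≤ (suc w * G) (m≤n+o⇒m∸n≤o M (A i) (h i ≤-refl)) ⟩
        suc w * G ∸ G               ≡⟨ m+n∸m≡n G (w * G) ⟩
        w * G                       ∎

  -- e^(i/W) ≥ 1 + i/W + (i/W)²/2 with e^(-1/W) replaced by 1 - 1/W, where W = 1 + w.
  exponential-bound : ∀ w i → let W = suc w in w ^ i * (2 * W * W + (2 * W * i + i * i)) ≤ W ^ i * (2 * W * W)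
  exponential-bound w zero    = ≤-reflexive (solve 1 (λ w → con 1 :* (con 2 :* (con 1 :+ w) :* (con 1 :+ w) :+ (con 2 :* (con 1 :+ w) :* con 0 :+ con 0)) := con 1 :* (con 2 :* (con 1 :+ w) :* (con 1 :+ w))) refl w)
  exponential-bound w (suc i) = begin
    w * w ^ i * f (suc i)   ≡⟨ solve 3 (λ a b c → a :* b :* c := b :* (a :* c)) refl w (w ^ i) (f (suc i)) ⟩
    w ^ i * (w * f (suc i)) ≤⟨ *-monoʳ-≤ (w ^ i) (m+n≤o⇒m≤o (w * f (suc i)) (≤-reflexive step)) ⟩
    w ^ i * (W * f i)       ≡⟨ solve 3 (λ a b c → b :* (a :* c) := a :* (b :* c)) refl W (w ^ i) (f i) ⟩
    W * (w ^ i * f i)       ≤⟨ *-monoʳ-≤ W (exponential-bound w i) ⟩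
    W * (W ^ i * (2 * W * W)) ≡⟨ *-assoc W (W ^ i) (2 * W * W) ⟨
    W * W ^ i * (2 * W * W) ∎
    where
    open ≤-Reasoning
    W = suc w
    f : ℕ → ℕ
    f i = 2 * W * W + (2 * W * i + i * i)
    -- The slack in `w * f (suc i) ≤ W * f i` is an explicit polynomial without negative
    -- coefficients, which makes the inequality a ring identity.
    step : w * f (suc i) + (i * i + w + 2 * i + 2) ≡ W * f i
    step = solve 2 (λ w i → let W = con 1 :+ w; i′ = con 1 :+ i in
      w :* (con 2 :* W :* W :+ (con 2 :* W :* i′ :+ i′ :* i′)) :+ (i :* i :+ w :+ con 2 :* i :+ con 2) :=
      W :* (con 2 :* W :* W :+ (con 2 :* W :* i :+ i :* i))) refl w i

  exceeds : ℕ → ℕ → ℕ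
  exceeds j d = ifZero (d ∸ j) 0 1

  ⊓-suc : ∀ j d → d ⊓ suc j ≡ d ⊓ j + exceeds j d
  ⊓-suc zero    zero    = refl
  ⊓-suc zero    (suc d) = cong suc (⊓-zeroʳ d)
  ⊓-suc (suc j) zero    = refl
  ⊓-suc (suc j) (suc d) = cong suc (⊓-suc j d)

  -- An object deeper than `j` pays `j` above the cut and `W` below it. By linearity this is where
  -- `A j + W * Q j` comes from.
  detour≡ : ∀ j W d → detour j W d ≡ d ⊓ j + W * exceeds j d
  detour≡ zero    W zero    = sym (*-zeroʳ W)
  detour≡ zero    W (suc d) = sym (*-identityʳ W)
  detour≡ (suc j) W zero    = sym (*-zeroʳ W)
  detour≡ (suc j) W (suc d) = trans (sym (detour-suc j W d)) (cong suc (detour≡ j W d))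

  module _ {n} (p : Fin n → ℚ) (d : Fin n → ℕ) (w i M : ℕ)
           (minimal : ∀ j → j < i → M ≤ numerator p (λ s → detour j (suc w) (d s))) where

    private
      W = suc w
      E = numerator p d
      g = 2 * W * i + i * i

      A Q : ℕ → ℕ
      A j = numerator p (λ s → d s ⊓ j)
      Q j = numerator p (λ s → exceeds j (d s))

      A₀ : A 0 ≡ 0
      A₀ = trans (numerator-cong p (λ s → ⊓-zeroʳ (d s))) (numerator-* p 0 d)

      A-suc : ∀ j → A (suc j) ≡ A j + Q j
      A-suc j = trans (numerator-cong p (λ s → ⊓-suc j (d s))) (numerator-+ p _ _)

      value≡ : ∀ j → numerator p (λ s → detour j W (d s)) ≡ A j + W * Q j
      value≡ j = trans (numerator-cong p (λ s → detour≡ j W (d s)))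
        (trans (numerator-+ p _ _) (cong (A j +_) (numerator-* p W _)))

      excess = M ∸ E

      excess≤ : W ^ i * ((2 * W * W + g) * excess) ≤ W ^ i * (2 * W * W * M)
      excess≤ = begin
        W ^ i * ((2 * W * W + g) * excess)     ≡⟨ solve 3 (λ a b c → a :* (b :* c) := b :* (a :* c)) refl (W ^ i) (2 * W * W + g) excess ⟩
        -- Truncating depths at `i` lowers the expectation, so `A i ≤ E`.
        (2 * W * W + g) * (W ^ i * excess)     ≤⟨ *-monoʳ-≤ (2 * W * W + g) (*-monoʳ-≤ (W ^ i) (∸-monoʳ-≤ M (numerator-mono p (λ s → m⊓n≤m (d s) i)))) ⟩
        (2 * W * W + g) * (W ^ i * (M ∸ A i))  ≤⟨ *-monoʳ-≤ (2 * W * W + g) (geometric-decay A Q w M A₀ A-suc i (λ j j<i → ≤-trans (minimal j j<i) (≤-reflexive (value≡ j)))) ⟩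
        (2 * W * W + g) * (w ^ i * M)          ≡⟨ solve 3 (λ a b c → b :* (a :* c) := a :* b :* c) refl (w ^ i) (2 * W * W + g) M ⟩
        w ^ i * (2 * W * W + g) * M            ≤⟨ *-monoˡ-≤ M (exponential-bound w i) ⟩
        W ^ i * (2 * W * W) * M                ≡⟨ *-assoc (W ^ i) (2 * W * W) M ⟩
        W ^ i * (2 * W * W * M)                ∎
        where open ≤-Reasoning

      M≤ : M ≤ E + excess
      M≤ = m≤n+m∸n M E

      -- After cancelling `W ^ i` and using `M ≤ E + excess`, the term `2 * W * W * excess` occurs
      -- on both sides.
      g*excess≤ : g * excess ≤ 2 * W * W * E
      g*excess≤ = +-cancelˡ-≤ (2 * W * W * excess) _ _ (begin
        2 * W * W * excess + g * excess        ≡⟨ *-distribʳ-+ excess (2 * W * W) g ⟨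
        (2 * W * W + g) * excess               ≤⟨ *-cancelˡ-≤ (W ^ i) {{m^n≢0 W i}} excess≤ ⟩
        2 * W * W * M                          ≤⟨ *-monoʳ-≤ (2 * W * W) M≤ ⟩
        2 * W * W * (E + excess)               ≡⟨ *-distribˡ-+ (2 * W * W) E excess ⟩
        2 * W * W * E + 2 * W * W * excess     ≡⟨ +-comm (2 * W * W * E) _ ⟩
        2 * W * W * excess + 2 * W * W * E     ∎)
        where open ≤-Reasoning

    -- With ρ = `i`/`W`, the number `g` is W²(ρ² + 2ρ), so this is M ≤ (1 + 2/(ρ² + 2ρ)) E without
    -- fractions.
    trade-off : (2 * W * i + i * i) * M ≤ (2 * W * W + (2 * W * i + i * i)) * E
    trade-off = begin
      g * M                     ≤⟨ *-monoʳ-≤ g M≤ ⟩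
      g * (E + excess)          ≡⟨ *-distribˡ-+ g E excess ⟩
      g * E + g * excess        ≤⟨ +-monoʳ-≤ (g * E) g*excess≤ ⟩
      g * E + 2 * W * W * E     ≡⟨ +-comm (g * E) _ ⟩
      2 * W * W * E + g * E     ≡⟨ *-distribʳ-+ E (2 * W * W) g ⟨
      (2 * W * W + g) * E       ∎
      where open ≤-Reasoning

  best-detour : ∀ {n} (p : Fin n → ℚ) (d : Fin n → ℕ) W i M .{{_ : ℕ.NonZero W}} →
    (∀ j → j < i → M ≤ numerator p (λ s → detour j W (d s))) →
    (2 * W * i + i * i) * M ≤ (2 * W * W + (2 * W * i + i * i)) * numerator p d
  best-detour p d zero    i M minimal = contradiction refl (ℕ.≢-nonZero⁻¹ 0)
  best-detour p d (suc w) i M minimal = trade-off p d w i M minimal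

-- From integers back to rational expectations.

module ExpectedCost where

  open Procedures using (numerator; denominator; denominator>0)
  open import Data.Nat.Base as ℕ using (ℕ; zero; suc)
  import Data.Nat.Properties as ℕ
  open import Data.Integer.Base as ℤ using (ℤ; +_; ∣_∣)
  import Data.Integer.Properties as ℤ
  open import Data.Rational.Base as ℚ using (ℚ; mkℚ; 0ℚ; 1ℚ; Positive; NonNegative; NonZero; _/_; _+_; _*_; _÷_; 1/_; _≤_; ↥_; ↧ₙ_; toℚᵘ; *≤*)
  open import Data.Rational.Properties as ℚ
  open import Data.Rational.Unnormalised.Base as ℚᵘ using (ℚᵘ; mkℚᵘ; *≡*)
  import Data.Rational.Unnormalised.Properties as ℚᵘ
  open import Data.Rational.Solver using (module +-*-Solver)
  open import Algebra.Definitions.RawMonoid ℚ.+-0-rawMonoid using () renaming (sum to ∑)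
  open import Data.Fin.Base using (Fin; zero; suc)
  open import Function.Base using (_∘_)
  open import Relation.Binary.PropositionalEquality.Core using (_≡_; refl; sym; trans; cong; cong₂; subst)
  open +-*-Solver

  ι : ℕ → ℚ
  ι n = + n / 1

  toℚᵘ-/ : ∀ i d → toℚᵘ (i / suc d) ℚᵘ.≃ mkℚᵘ i d
  toℚᵘ-/ i d = toℚᵘ-fromℚᵘ (mkℚᵘ i d)

  -- Since `_/_` reduces by a gcd, the equation is checked on unnormalised fractions, where it is an
  -- identity of integers.
  ι-+ : ∀ m n → ι (m ℕ.+ n) ≡ ι m + ι n
  ι-+ m n = toℚᵘ-injective (begin
    toℚᵘ (ι (m ℕ.+ n))            ≈⟨ toℚᵘ-/ (+ (m ℕ.+ n)) 0 ⟩
    mkℚᵘ (+ (m ℕ.+ n)) 0          ≈⟨ *≡* (cong (ℤ._* + 1) (sym (cong₂ ℤ._+_ (ℤ.*-identityʳ (+ m)) (ℤ.*-identityʳ (+ n))))) ⟩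
    mkℚᵘ (+ m) 0 ℚᵘ.+ mkℚᵘ (+ n) 0 ≈⟨ ℚᵘ.+-cong (toℚᵘ-/ (+ m) 0) (toℚᵘ-/ (+ n) 0) ⟨
    toℚᵘ (ι m) ℚᵘ.+ toℚᵘ (ι n)    ≈⟨ toℚᵘ-homo-+ (ι m) (ι n) ⟨
    toℚᵘ (ι m + ι n)              ∎)
    where open ℚᵘ.≃-Reasoning

  ι-* : ∀ m n → ι (m ℕ.* n) ≡ ι m * ι n
  ι-* m n = toℚᵘ-injective (begin
    toℚᵘ (ι (m ℕ.* n))            ≈⟨ toℚᵘ-/ (+ (m ℕ.* n)) 0 ⟩
    mkℚᵘ (+ (m ℕ.* n)) 0          ≈⟨ *≡* (cong (ℤ._* + 1) (ℤ.pos-* m n)) ⟩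
    mkℚᵘ (+ m) 0 ℚᵘ.* mkℚᵘ (+ n) 0 ≈⟨ ℚᵘ.*-cong (toℚᵘ-/ (+ m) 0) (toℚᵘ-/ (+ n) 0) ⟨
    toℚᵘ (ι m) ℚᵘ.* toℚᵘ (ι n)    ≈⟨ toℚᵘ-homo-* (ι m) (ι n) ⟨
    toℚᵘ (ι m * ι n)              ∎)
    where open ℚᵘ.≃-Reasoning

  /-*-ι : ∀ k n .{{_ : ℕ.NonZero n}} → (+ k / n) * ι n ≡ ι k
  /-*-ι k (suc w) = toℚᵘ-injective (begin
    toℚᵘ ((+ k / suc w) * ι (suc w))          ≈⟨ toℚᵘ-homo-* (+ k / suc w) (ι (suc w)) ⟩
    toℚᵘ (+ k / suc w) ℚᵘ.* toℚᵘ (ι (suc w))  ≈⟨ ℚᵘ.*-cong (toℚᵘ-/ (+ k) w) (toℚᵘ-/ (+ suc w) 0) ⟩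
    mkℚᵘ (+ k) w ℚᵘ.* mkℚᵘ (+ suc w) 0        ≈⟨ *≡* (trans (ℤ.*-identityʳ (+ k ℤ.* + suc w)) (cong (λ d → + k ℤ.* + suc d) (sym (ℕ.*-identityʳ w)))) ⟩
    mkℚᵘ (+ k) 0                              ≈⟨ toℚᵘ-/ (+ k) 0 ⟨
    toℚᵘ (ι k)                                ∎)
    where open ℚᵘ.≃-Reasoning

  ι-nonNegative : ∀ n → NonNegative (ι n)
  ι-nonNegative n = normalize-nonNeg n 1

  ι-positive : ∀ n .{{_ : ℕ.NonZero n}} → Positive (ι n)
  ι-positive n = normalize-pos n 1

  ι-mono : ∀ {m n} → m ℕ.≤ n → ι m ≤ ι n
  ι-mono {m} {n} m≤n = begin
    ι m                 ≡⟨ +-identityʳ (ι m) ⟨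
    ι m + 0ℚ            ≤⟨ +-monoʳ-≤ (ι m) (nonNegative⁻¹ (ι (n ℕ.∸ m)) {{ι-nonNegative (n ℕ.∸ m)}}) ⟩
    ι m + ι (n ℕ.∸ m)   ≡⟨ ι-+ m (n ℕ.∸ m) ⟨
    ι (m ℕ.+ (n ℕ.∸ m)) ≡⟨ cong ι (ℕ.m+[n∸m]≡n m≤n) ⟩
    ι n                 ∎
    where open ≤-Reasoning

  ι-injective : ∀ {m n} → ι m ≡ ι n → m ≡ n
  ι-injective {m} {n} eq = trans (sym (ℕ.*-identityʳ m)) (trans (normalize-injective-≃ m n 1 1 eq) (ℕ.*-identityʳ n))

  *-ι-↧ : ∀ q → 0ℚ ≤ q → q * ι (↧ₙ q) ≡ ι ∣ ↥ q ∣
  *-ι-↧ q@(mkℚ (+ a) _ _) _ = subst (λ q′ → q′ * ι (↧ₙ q) ≡ ι a) (↥p/↧p≡p q) (/-*-ι a (↧ₙ q))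
  *-ι-↧ (mkℚ ℤ.-[1+ _ ] _ _) (*≤* ())

  -- This ties the program's integers to `expectedCost`; non-negativity lets the encoded absolute
  -- value stand for the signed numerator.
  ∑-*-denominator : ∀ {n} (p : Fin n → ℚ) (v : Fin n → ℕ) → (∀ s → 0ℚ ≤ p s) →
                    (∑ λ s → ι (v s) * p s) * ι (denominator p) ≡ ι (numerator p v)
  ∑-*-denominator {zero}  p v 0≤p = refl
  ∑-*-denominator {suc n} p v 0≤p = begin-equality
    (ι v₀ * p₀ + S) * ι (b ℕ.* D)             ≡⟨ cong ((ι v₀ * p₀ + S) *_) (ι-* b D) ⟩
    (ι v₀ * p₀ + S) * (ι b * ι D)             ≡⟨ solve 5 (λ v p s b d → (v :* p :+ s) :* (b :* d) := (p :* b) :* v :* d :+ b :* (s :* d)) refl (ι v₀) p₀ S (ι b) (ι D) ⟩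
    (p₀ * ι b) * ι v₀ * ι D + ι b * (S * ι D) ≡⟨ cong₂ (λ x y → x * ι v₀ * ι D + ι b * y) (*-ι-↧ p₀ (0≤p zero)) (∑-*-denominator (p ∘ suc) (v ∘ suc) (0≤p ∘ suc)) ⟩
    ι a * ι v₀ * ι D + ι b * ι m              ≡⟨ cong₂ _+_ (trans (ι-* (a ℕ.* v₀) D) (cong (_* ι D) (ι-* a v₀))) (ι-* b m) ⟨
    ι (a ℕ.* v₀ ℕ.* D) + ι (b ℕ.* m)          ≡⟨ ι-+ (a ℕ.* v₀ ℕ.* D) (b ℕ.* m) ⟨
    ι (a ℕ.* v₀ ℕ.* D ℕ.+ b ℕ.* m)            ∎
    where
    open ≤-Reasoning
    p₀ = p zero
    v₀ = v zero
    a = ∣ ↥ p₀ ∣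
    b = ↧ₙ p₀
    D = denominator (p ∘ suc)
    m = numerator (p ∘ suc) (v ∘ suc)
    S = ∑ λ s → ι (v (suc s)) * p (suc s)

  module _ {ρ : ℚ} {k W : ℕ} .{{_ : ℕ.NonZero W}} (ρ*W≡k : ρ * ι W ≡ ι k) where

    -- Identifies the feasibility test of `best` with `j ≤ k`.
    numerator-ratio : 0ℚ ≤ ρ → ∣ ↥ ρ ∣ ℕ.* W ≡ k ℕ.* ↧ₙ ρ
    numerator-ratio 0≤ρ = ι-injective (begin-equality
      ι (∣ ↥ ρ ∣ ℕ.* W)      ≡⟨ ι-* ∣ ↥ ρ ∣ W ⟩
      ι ∣ ↥ ρ ∣ * ι W        ≡⟨ cong (_* ι W) (*-ι-↧ ρ 0≤ρ) ⟨
      ρ * ι (↧ₙ ρ) * ι W     ≡⟨ solve 3 (λ r b w → r :* b :* w := r :* w :* b) refl ρ (ι (↧ₙ ρ)) (ι W) ⟩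
      ρ * ι W * ι (↧ₙ ρ)     ≡⟨ cong (_* ι (↧ₙ ρ)) ρ*W≡k ⟩
      ι k * ι (↧ₙ ρ)         ≡⟨ ι-* k (↧ₙ ρ) ⟨
      ι (k ℕ.* ↧ₙ ρ)         ∎)
      where open ≤-Reasoning

    [1+ρ]*W : (1ℚ + ρ) * ι W ≡ ι (W ℕ.+ k)
    [1+ρ]*W = trans (solve 2 (λ r w → (con 1ℚ :+ r) :* w := w :+ r :* w) refl ρ (ι W))
      (trans (cong (λ x → ι W + x) ρ*W≡k) (sym (ι-+ W k)))

    module _ {n} (p : Fin n → ℚ) (0≤p : ∀ s → 0ℚ ≤ p s) (u d : Fin n → ℕ) .{{_ : Positive ρ}}
      (h : (2 ℕ.* W ℕ.* k ℕ.+ k ℕ.* k) ℕ.* numerator p u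
             ℕ.≤ (2 ℕ.* W ℕ.* W ℕ.+ (2 ℕ.* W ℕ.* k ℕ.+ k ℕ.* k)) ℕ.* numerator p d) where

      private
        q = ρ * ρ + ι 2 * ρ
        C = ∑ λ s → ι (u s) * p s
        E = ∑ λ s → ι (d s) * p s
        Δ = ι (denominator p)
        g = 2 ℕ.* W ℕ.* k ℕ.+ k ℕ.* k

        q-positive : Positive q
        q-positive = pos+pos⇒pos (ρ * ρ) {{pos*pos⇒pos ρ ρ}} (ι 2 * ρ) {{pos*pos⇒pos (ι 2) ρ}}

        instance
          q-nonZero : NonZero q
          q-nonZero = ρ²+2ρ-nonZero ρ

        -- Clears all denominators at once: `q` that of the quotient, the square of `W` that of `q`
        -- itself, and `Δ` those of the probabilities.
        Z = q * (ι W * ι W * Δ)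

        Z-positive : Positive Z
        Z-positive = pos*pos⇒pos q {{q-positive}} (ι W * ι W * Δ)
          {{pos*pos⇒pos (ι W * ι W) {{pos*pos⇒pos (ι W) {{ι-positive W}} (ι W) {{ι-positive W}}}} Δ
            {{ι-positive (denominator p) {{ℕ.>-nonZero (denominator>0 p)}}}}}}

        ι-2*W* : ∀ j → ι (2 ℕ.* W ℕ.* j) ≡ ι 2 * ι W * ι j
        ι-2*W* j = trans (ι-* (2 ℕ.* W) j) (cong (_* ι j) (ι-* 2 W))

        ι-g : q * (ι W * ι W) ≡ ι g
        ι-g = begin-equality
          q * (ι W * ι W)                               ≡⟨ solve 3 (λ r w c → (r :* r :+ c :* r) :* (w :* w) := c :* w :* (r :* w) :+ (r :* w) :* (r :* w)) refl ρ (ι W) (ι 2) ⟩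
          ι 2 * ι W * (ρ * ι W) + (ρ * ι W) * (ρ * ι W) ≡⟨ cong (λ x → ι 2 * ι W * x + x * x) ρ*W≡k ⟩
          ι 2 * ι W * ι k + ι k * ι k                   ≡⟨ cong₂ _+_ (ι-2*W* k) (ι-* k k) ⟨
          ι (2 ℕ.* W ℕ.* k) + ι (k ℕ.* k)               ≡⟨ ι-+ (2 ℕ.* W ℕ.* k) (k ℕ.* k) ⟨
          ι g                                           ∎
          where open ≤-Reasoning

      expected-cost-bound : C ≤ (1ℚ + ι 2 ÷ q) * E
      expected-cost-bound = *-cancelʳ-≤-pos Z {{Z-positive}} (begin
        C * Z                                  ≡⟨ solve 4 (λ c q x t → c :* (q :* (x :* t)) := q :* x :* (c :* t)) refl C q (ι W * ι W) Δ ⟩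
        q * (ι W * ι W) * (C * Δ)              ≡⟨ cong₂ _*_ ι-g (∑-*-denominator p u 0≤p) ⟩
        ι g * ι (numerator p u)                ≡⟨ ι-* g (numerator p u) ⟨
        ι (g ℕ.* numerator p u)                ≤⟨ ι-mono h ⟩
        ι ((2 ℕ.* W ℕ.* W ℕ.+ g) ℕ.* numerator p d) ≡⟨ trans (ι-* (2 ℕ.* W ℕ.* W ℕ.+ g) (numerator p d)) (cong (_* ι (numerator p d)) (ι-+ (2 ℕ.* W ℕ.* W) g)) ⟩
        (ι (2 ℕ.* W ℕ.* W) + ι g) * ι (numerator p d) ≡⟨ cong₂ _*_ (cong₂ _+_ (ι-2*W* W) (sym ι-g)) (sym (∑-*-denominator p d 0≤p)) ⟩
        (ι 2 * ι W * ι W + q * (ι W * ι W)) * (E * Δ) ≡⟨ solve 5 (λ c w q e t → (c :* w :* w :+ q :* (w :* w)) :* (e :* t) := (q :+ c :* con 1ℚ) :* e :* (w :* w :* t)) refl (ι 2) (ι W) q E Δ ⟩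
        -- The 1 becomes `1/ q * q`, so that `q` can be factored out and absorbed into `Z`.
        (q + ι 2 * 1ℚ) * E * (ι W * ι W * Δ)   ≡⟨ cong (λ x → (q + ι 2 * x) * E * (ι W * ι W * Δ)) (*-inverseˡ q) ⟨
        (q + ι 2 * (1/ q * q)) * E * (ι W * ι W * Δ) ≡⟨ solve 5 (λ c r q e y → (q :+ c :* (r :* q)) :* e :* y := (con 1ℚ :+ c :* r) :* e :* (q :* y)) refl (ι 2) (1/ q) q E (ι W * ι W * Δ) ⟩
        (1ℚ + ι 2 * 1/ q) * E * Z              ∎)
        where open ≤-Reasoning

-- Polynomial running time and correctness of the output.

module Correctness where

  open Evaluation
  open Algorithm
  open Procedures
  open Pruning
  open TradeOff
  open ExpectedCost
  open import Data.Nat.Base as ℕ using (ℕ; zero; suc; _+_; _*_; _^_; _≤_; _<_; z≤n; s≤s)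
  open import Data.Nat.Properties as ℕ
  open import Data.Nat.Solver using (module +-*-Solver)
  open import Data.Integer.Base as ℤ using (ℤ; +_; ∣_∣)
  open import Data.Rational.Base as ℚ using (ℚ; 1ℚ; Positive; _/_; _÷_; ↥_; ↧ₙ_)
  import Data.Rational.Properties as ℚ
  open import Algebra.Definitions.RawMonoid ℚ.+-0-rawMonoid using () renaming (sum to ∑)
  open import Data.Fin.Base using (Fin; zero; suc)
  open import Data.Fin.Subset using (⊤; Nonempty)
  open import Data.Fin.Subset.Properties using (⊆-refl; ∈⊤)
  open import Data.Bool.Base using (T)
  open import Data.List.Relation.Unary.All using ([]; _∷_)
  open import Data.Product.Base using (∃-syntax; Σ-syntax; _×_; _,_; proj₁; proj₂)
  open import Data.Sum.Base using (inj₁; inj₂)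
  open import Function.Base using (_∘_)
  open import Relation.Nullary.Negation using (contradiction)
  open import Relation.Binary.PropositionalEquality.Core using (_≡_; refl; sym; trans; cong; subst)

  length≤size-vector : ∀ {n} (f : Fin n → Value) → n ≤ size (encodeVector f)
  length≤size-vector {zero}  f = z≤n
  length≤size-vector {suc n} f = s≤s (≤-trans (length≤size-vector (f ∘ suc)) (m≤n+m _ _))

  size-lookup : ∀ {n} (f : Fin n → Value) i → size (f i) ≤ size (encodeVector f)
  size-lookup f zero    = m≤n⇒m≤1+n (m≤m+n _ _)
  size-lookup f (suc i) = m≤n⇒m≤1+n (≤-trans (size-lookup (f ∘ suc) i) (m≤n+m _ (size (f zero))))

  -- Some object exists, hence the set of all objects is non-empty and pruning yields a tree rather
  -- than `none`.
  ∑≡1⇒inhabited : ∀ {n} (p : Fin n → ℚ) → ∑ p ≡ 1ℚ → Fin n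
  ∑≡1⇒inhabited {zero}  p ()
  ∑≡1⇒inhabited {suc n} p _ = zero

  positive-quotient : ∀ {ρ i W} .{{_ : Positive ρ}} .{{_ : ℕ.NonZero W}} → ρ ≡ i / W → ∃[ k ] i ≡ + k
  positive-quotient {i = + k} _ = k , refl
  positive-quotient {i = ℤ.-[1+ m ]} {W} refl = contradiction
    (ℚ.neg-antimono-< (ℚ.positive⁻¹ (ℚ.normalize (suc m) W) {{ℚ.normalize-pos (suc m) W}}))
    (ℚ.<-asym (ℚ.positive⁻¹ (ℤ.-[1+ m ] / W)))

  ^-distribʳ-* : ∀ e m n → (m * n) ^ e ≡ m ^ e * n ^ e
  ^-distribʳ-* zero    m n = refl
  ^-distribʳ-* (suc e) m n = trans (cong (m * n *_) (^-distribʳ-* e m n))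
    (solve 4 (λ m n x y → m :* n :* (x :* y) := m :* x :* (n :* y)) refl m n (m ^ e) (n ^ e))
    where open +-*-Solver

  nonempty-branch : ∀ {I U} (b : Branch I U) → Nonempty U → ∃[ ne ] ∃[ D ] b ≡ child ne D
  nonempty-branch (none e)     ne = contradiction ne e
  nonempty-branch (child ne D) _  = ne , D , refl

  infix 4 _⊑_

  -- Keeps the value visible in the type, so that a path of `left` and `right` through the encoded
  -- input proves a size bound.
  record _⊑_ (n : ℕ) (v : Value) : Set where
    constructor fitting
    field
      ≤size : n ≤ size v

  left : ∀ {n v w} → n ⊑ v → n ⊑ v ∙ w
  left (fitting n≤) = fitting (m≤n⇒m≤1+n (≤-trans n≤ (m≤m+n _ _)))

  right : ∀ {n v w} → n ⊑ w → n ⊑ v ∙ w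
  right {v = v} (fitting n≤) = fitting (m≤n⇒m≤1+n (≤-trans n≤ (m≤n+m _ (size v))))

  whole : ∀ {v} → size v ⊑ v
  whole = fitting ≤-refl

  number : ∀ {n} → bits n ⊑ num n
  number = fitting (n≤1+n _)

  opaque
    -- `level 7` is `N ^ 8` with `N = S * 512`. Opacity keeps the power symbolic.
    coefficient : ℕ
    coefficient = 512 ^ 8

    [S*512]^8 : ∀ S → (S * 512) ^ 8 ≡ coefficient * S ^ 8
    [S*512]^8 S = trans (^-distribʳ-* 8 S 512) (*-comm (S ^ 8) (512 ^ 8))

  -- S is kept abstract, as it would otherwise be unfolded to a successor.
  module Main (I : DFEP) (unit : UnitCost I) (D-E D-W : DecisionTree I) (ρ : ℚ)
              (S : ℕ) (size≡S : size (encodeInput I D-E D-W ρ) ≡ S) where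
    open DFEP I
    open Trees I

    N W H a b : ℕ
    -- The factor covers the steps of one body and also leaves room for `S + S + S`, the bit length
    -- of a weight.
    N = S * 512
    W = height D-W
    H = height D-E
    a = ∣ ↥ ρ ∣
    b = ↧ₙ ρ

    private
      probabilitiesᵛ : Value
      probabilitiesᵛ = encodeVector (λ s → encodeℚ (p s))

      ⊑⇒≤S : ∀ {n} → n ⊑ encodeInput I D-E D-W ρ → n ≤ S
      ⊑⇒≤S (fitting n≤) = ≤-trans n≤ (≤-reflexive size≡S)

      objects≤S : #objects ≤ S
      objects≤S = ⊑⇒≤S (left (right (left (fitting (length≤size-vector _)))))

      tests≤S : #tests ≤ S
      tests≤S = ⊑⇒≤S (left (right (right (left (fitting (length≤size-vector _))))))

      probabilities≤S : size probabilitiesᵛ ≤ S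
      probabilities≤S = ⊑⇒≤S (left (right (right (right (left whole)))))

      classes≤S : bits #classes ≤ S
      classes≤S = ⊑⇒≤S (left (left (right (left number))))

      outcomes≤S : bits ℓ ≤ S
      outcomes≤S = ⊑⇒≤S (left (left (right (right (right number)))))

      D-E≤S : size (encodeTree D-E) ≤ S
      D-E≤S = ⊑⇒≤S (right (left whole))

      D-W≤S : size (encodeTree D-W) ≤ S
      D-W≤S = ⊑⇒≤S (right (right (left whole)))

      a≤S : bits a ≤ S
      a≤S = ⊑⇒≤S (right (right (right (left number))))

      b≤S : bits b ≤ S
      b≤S = ⊑⇒≤S (right (right (right (right number))))

      instance
        S-nonZero : ℕ.NonZero S
        S-nonZero = ℕ.>-nonZero (≤-trans (s≤s z≤n) (≤-reflexive size≡S))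

      S<N : S < N
      S<N = m<m*n S 512 (s≤s (s≤s z≤n))

      512≤N : 512 ≤ N
      512≤N = m≤n*m 512 S

    open Specification N 512≤N unit (≤-<-trans objects≤S S<N) (<⇒≤ (≤-<-trans tests≤S S<N))
      (short (<⇒≤ (≤-<-trans classes≤S S<N))) (short (<⇒≤ (≤-<-trans outcomes≤S S<N)))

    d : Object → ℕ
    d = cost D-E

    weight : ℕ → ℕ
    weight j = numerator p (λ s → detour j W (d s))

    -- The search runs up to `H`, which is polynomially bounded, and not up to `ρ * W`, which need
    -- not be.
    j* : ℕ
    j* = best weight a b W H

    private
      d≤S : ∀ s → d s ≤ S
      d≤S s = ≤-trans (cost≤size unit D-E s) D-E≤S

      H≤S : H ≤ S
      H≤S = maximum-≤ d d≤S

      W≤S : W ≤ S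
      W≤S = maximum-≤ (cost D-W) λ s → ≤-trans (cost≤size unit D-W s) D-W≤S

      j*≤S : j* ≤ S
      j*≤S = ≤-trans (best-≤ weight a b W H) H≤S

      S≤N : S ≤ N
      S≤N = <⇒≤ S<N

      3S≤N : S + S + S ≤ N
      3S≤N = ≤-trans (≤-reflexive (solve 1 (λ s → s :+ s :+ s := s :* con 3) refl S)) (*-monoʳ-≤ S (≤ᵇ⇒≤ 3 512 _))
        where open +-*-Solver

      2S≤N : S + S ≤ N
      2S≤N = m+n≤o⇒m≤o (S + S) 3S≤N

      short-* : ∀ m {n} → bits m ≤ S → n ≤ S → Short N (m * n)
      short-* m {n} m≤ n≤ = short (≤-trans (bits-* m n) (≤-trans (+-mono-≤ m≤ (≤-trans (bits≤ n) n≤)) 2S≤N))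

      num-short : ∀ s → Short N ∣ ↥ p s ∣
      num-short s = short (≤-trans (_⊑_.≤size {v = encodeℚ (p s)} (left number)) (≤-trans (≤-trans (size-lookup (λ s → encodeℚ (p s)) s) probabilities≤S) S≤N))

      denominator-short : Short N (denominator p)
      denominator-short = short (≤-trans (bits-<2^ (≤-<-trans (denominator-≤ p) (^-monoʳ-< 2 (s≤s (s≤s z≤n)) (s≤s probabilities≤S)))) S<N)

      -- The detours are at most `j + W`, which is small by value, so even the crude `n < 2 ^ n`
      -- leaves only `S + S + S` bits.
      weight-short : ∀ {j} → j ≤ H → Short N (weight j)
      weight-short {j} j≤H = short (≤-trans (bits-<2^ {k = V + X} (begin-strict
        weight j      ≤⟨ numerator-≤ p _ (λ s → detour-≤ j W (d s)) ⟩
        V * 2 ^ X     <⟨ *-monoˡ-< (2 ^ X) {{m^n≢0 2 X}} (n<2^n V) ⟩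
        2 ^ V * 2 ^ X ≡⟨ ^-distribˡ-+-* 2 V X ⟨
        2 ^ (V + X)   ∎)) (≤-trans (+-mono-≤ (+-mono-≤ (≤-trans j≤H H≤S) W≤S) probabilities≤S) 3S≤N))
        where
        open ≤-Reasoning
        V = j + W
        X = size probabilitiesᵛ

      j*-calls : Calls bestᶠ (num H ∙ (num a ∙ num b) ∙ probabilitiesᵛ ∙ encodeNumbers d ∙ num W) (num j*) (level 5)
      j*-calls = weaken (scale (≤-<-trans H≤S S<N)) (best-calls p d (≤-<-trans objects≤S S<N) num-short (λ s → ≤-trans (d≤S s) S≤N)
        (≤-trans (+-mono-≤ H≤S W≤S) 2S≤N) weight-short denominator-short
        (short (≤-trans a≤S S≤N)) (short (≤-trans b≤S S≤N)) (short-* a a≤S W≤S)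
        (subst (Short N) (*-comm b H) (short-* b b≤S H≤S)) H ≤-refl)

      pruned : Branch I ⊤
      pruned = prune D-W (suc j*) D-E ⊆-refl (survey class ⊤)

      pruned-child : ∃[ ne ] ∃[ D ] pruned ≡ child ne D
      pruned-child = nonempty-branch pruned (∑≡1⇒inhabited p p-total , ∈⊤)

    output : DecisionTree I
    output = proj₁ (proj₂ pruned-child)

    private
      pruned≡output : pruned ≡ child (proj₁ pruned-child) output
      pruned≡output = proj₂ (proj₂ pruned-child)

      cutting : Value
      cutting = (classesᵛ ∙ testsᵛ ∙ encodeTree D-W) ∙ num (suc j*) ∙ encodeSubset (⊤ {#objects}) ∙ encodeTree D-E

      output-calls : Calls pruneᶠ cutting (encodeTree output ∙ num 0) (level 6)
      output-calls = subst (λ b → Calls pruneᶠ cutting (encodePruned b) (level 6)) pruned≡output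
        (cut-calls D-W (≤-trans D-W≤S S≤N) j* D-E (≤-trans D-E≤S S≤N) (≤-<-trans j*≤S S<N))

      maximum-calls′ : (D : DecisionTree I) → size (encodeTree D) ≤ S → Calls maximumᶠ (encodeNumbers (cost D)) (num (height D)) (level 2)
      maximum-calls′ D D≤S = weaken (scale (≤-<-trans objects≤S S<N))
        (maximum-calls (cost D) λ s → ≤-trans (≤-trans (cost≤size unit D s) D≤S) S≤N)

    main-calls : Calls mainᶠ (encodeInput I D-E D-W ρ) (encodeTree output) (level 7)
    main-calls = calls mainᶠ
      (_ , _ , depths-calls D-E (≤-<-trans D-E≤S S<N) _ ,
       _ , _ , depths-calls D-W (≤-<-trans D-W≤S S<N) _ ,
       _ , _ , maximum-calls′ D-W D-W≤S ,
       _ , _ , maximum-calls′ D-E D-E≤S ,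
       _ , _ , j*-calls ,
       ≤N⇒short (≤-trans (s≤s z≤n) 512≤N) , ≤N⇒short (≤-trans j*≤S S≤N) ,
       _ , _ , weaken (scale (≤-<-trans objects≤S S<N)) (all-calls _) ,
       _ , _ , output-calls ,
       -- The bounds are listed with the latest call first.
       return refl (fits (≤-refl ∷ to6 2 ∷ to6 5 ∷ to6 2 ∷ to6 2 ∷ ≤-refl ∷ ≤-refl ∷ [])))
      where
      to6 : ∀ e {_ : T (e ℕ.≤ᵇ 6)} → level e ≤ level 6
      to6 e {e≤6} = level-mono (≤ᵇ⇒≤ e 6 e≤6)

    level-7 : level 7 ≡ coefficient * S ^ 8
    level-7 = trans (level-^ 7) ([S*512]^8 S)

    running : Σ[ τ ∈ ℕ ] (program code on encodeInput I D-E D-W ρ yields encodeTree output inTime τ) × τ ≤ coefficient * S ^ 8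
    running = _ , Calls.evaluates main-calls , ≤-trans (Calls.time≤ main-calls) (≤-reflexive level-7)

    output-cost : ∀ s → cost output s ≤ detour j* W (d s)
    output-cost s = ≤-trans (≤-reflexive (sym (cong (λ b → branchCost b s) pruned≡output)))
      (prune-cost D-W unit (≤-maximum (cost D-W)) j* D-E ⊆-refl (survey class ⊤) s)

    module _ {k : ℕ} .{{_ : ℕ.NonZero W}} .{{_ : Positive ρ}} (a*W≡k*b : a * W ≡ k * b) where

      j*≤k : j* ≤ k
      j*≤k = *-cancelʳ-≤ j* k b (≤-trans (best-feasible weight a b W H) (≤-reflexive a*W≡k*b))

      height-≤ : height output ≤ W + k
      height-≤ = maximum-≤ (cost output) λ s → begin
        cost output s        ≤⟨ output-cost s ⟩
        detour j* W (d s)    ≤⟨ detour-≤ j* W (d s) ⟩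
        j* + W               ≤⟨ +-monoˡ-≤ W j*≤k ⟩
        k + W                ≡⟨ +-comm k W ⟩
        W + k                ∎
        where open ≤-Reasoning

      minimal : ∀ j → j < k → weight j* ≤ weight j
      minimal j j<k with ≤-total j H
      ... | inj₁ j≤H = best-minimal weight a b W H j≤H (≤-trans (*-monoˡ-≤ b (<⇒≤ j<k)) (≤-reflexive (sym a*W≡k*b)))
      -- No object of `D-E` is deeper than `H`, so cutting at `j` weighs the same as cutting at `H`,
      -- which is among the candidates.
      ... | inj₂ H≤j = ≤-trans
        (best-minimal weight a b W H ≤-refl (≤-trans (*-monoˡ-≤ b (≤-trans H≤j (<⇒≤ j<k))) (≤-reflexive (sym a*W≡k*b))))
        (≤-reflexive (numerator-cong p λ s → trans (detour-id (≤-maximum d s)) (sym (detour-id (≤-trans (≤-maximum d s) H≤j)))))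

      weighted-≤ : (2 * W * k + k * k) * numerator p (cost output) ≤ (2 * W * W + (2 * W * k + k * k)) * numerator p d
      weighted-≤ = ≤-trans (*-monoʳ-≤ (2 * W * k + k * k) (numerator-mono p output-cost)) bound
        where
        bound : (2 * W * k + k * k) * weight j* ≤ (2 * W * W + (2 * W * k + k * k)) * numerator p d
        bound = best-detour p d W k (weight j*) minimal

  correct : (I : DFEP) → UnitCost I → (D-E D-W : DecisionTree I) (ρ : ℚ)
    .{{_ : Positive ρ}} .{{_ : ℕ.NonZero (height D-W)}} → (Σ[ i ∈ ℤ ] ρ ≡ i / height D-W) →
    Σ[ D ∈ DecisionTree I ] Σ[ τ ∈ ℕ ]
      (program code on encodeInput I D-E D-W ρ yields encodeTree D inTime τ)
      × τ ≤ coefficient * size (encodeInput I D-E D-W ρ) ^ 8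
      × ι (height D) ℚ.≤ (1ℚ ℚ.+ ρ) ℚ.* ι (height D-W)
      × expectedCost D ℚ.≤ (1ℚ ℚ.+ _÷_ (ι 2) (ρ ℚ.* ρ ℚ.+ ι 2 ℚ.* ρ) {{ρ²+2ρ-nonZero ρ}}) ℚ.* expectedCost D-E
  correct I unit D-E D-W ρ (i , ρ≡i/W) =
    output , proj₁ running , proj₁ (proj₂ running) , proj₂ (proj₂ running) ,
    ℚ.≤-trans (ι-mono (height-≤ {k} a*W≡k*b)) (ℚ.≤-reflexive (sym ([1+ρ]*W {ρ} {k} {W} ρ*W≡k))) ,
    expected-cost-bound {ρ} {k} {W} ρ*W≡k p p-nonNegative (cost output) d (weighted-≤ {k} a*W≡k*b)
    where
    open DFEP I
    open Main I unit D-E D-W ρ _ refl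
    i≡k = positive-quotient {ρ} {i} {W} ρ≡i/W
    k = proj₁ i≡k
    ρ*W≡k : ρ ℚ.* ι W ≡ ι k
    ρ*W≡k = trans (cong (ℚ._* ι W) (trans ρ≡i/W (cong (_/ W) (proj₂ i≡k)))) (/-*-ι k W)
    a*W≡k*b : a * W ≡ k * b
    a*W≡k*b = numerator-ratio {ρ} {k} {W} ρ*W≡k (ℚ.<⇒≤ (ℚ.positive⁻¹ ρ))

open Algorithm using (code)
open Correctness using (coefficient; correct)
open import Data.Nat.Base as ℕ using (ℕ)
open import Data.Integer.Base using (ℤ; +_)
open import Data.Rational.Base using (ℚ; 1ℚ; Positive; _/_; _+_; _*_; _÷_; _≤_)
open import Data.Product.Base using (_×_; Σ-syntax)
open import Relation.Binary.PropositionalEquality.Core using (_≡_)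
open import Data.Product.Base using (_,_)
open import Relation.Binary.PropositionalEquality.Core using (refl)

theorem3 : Σ[ P ∈ Program ] Σ[ a ∈ ℕ ] Σ[ b ∈ ℕ ]
    ((I : DFEP) → UnitCost I →
    (D-E D-W : DecisionTree I) (E : ℚ) (W : ℕ) →
    expectedCost D-E ≡ E → height D-W ≡ W →
    (ρ : ℚ) .{{_ : Positive ρ}} .{{_ : ℕ.NonZero W}} →
    (Σ[ i ∈ ℤ ] ρ ≡ i / W) →
    Σ[ D ∈ DecisionTree I ] Σ[ τ ∈ ℕ ]
    (P on encodeInput I D-E D-W ρ yields encodeTree D inTime τ)
    × τ ℕ.≤ a ℕ.* size (encodeInput I D-E D-W ρ) ℕ.^ b
    × (+ height D / 1) ≤ (1ℚ + ρ) * (+ W / 1)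
    × expectedCost D ≤
    (1ℚ + _÷_ (+ 2 / 1) (ρ * ρ + (+ 2 / 1) * ρ) {{ρ²+2ρ-nonZero ρ}}) * E)
theorem3 = program code , coefficient , 8 , λ where
  I unit D-E D-W _ _ refl refl ρ i/W → correct I unit D-E D-W ρ i/W
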